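{- Let $K_2$ be the graph consisting of two vertices and a single edge. Then $h(K_2)=1$, but $h_Q(\mathbf{B}_{K_2})\le\frac12$.
   Context: For a $d$-regular graph $G=([n],E)$, the edge expansion is $h(G)=\min_{W\subseteq[n],\,1\le|W|\le n/2}\frac{|\partial W|}{d|W|}$, where $\partial W=\{\{i,j\}\in E: i\in W,\ j\in[n]\setminus W\}$. The graphical matrix tuple $\mathbf{B}_G$ is the tuple of the $2|E|=dn$ matrices $\sqrt n\,\mathrm{E}_{i,j}\in\mathrm{M}(n,\mathbb{C})$ indexed by ordered pairs $(i,j)$ with $\{i,j\}\in E$, where $\mathrm{E}_{i,j}$ has a $1$ in position $(i,j)$ and zeros elsewhere. Thus $\mathbf{B}_{K_2}=\left(\begin{bmatrix}0&\sqrt2\\0&0\end{bmatrix},\begin{bmatrix}0&0\\\sqrt2&0\end{bmatrix}\right)$. A tuple $\mathbf{B}=(B_1,\dots,B_m)\in\mathrm{M}(n,\mathbb{C})^m$ is doubly stochastic if $\sum_iB_iB_i^*=\sum_iB_i^*B_i=mI_n$ (this holds for $\mathbf{B}_G$). For such a tuple let $\Phi_{\mathbf{B}}(X)=\frac1m\sum_{i=1}^mB_iXB_i^*$. With $P_V$ the orthogonal projection onto $V$ and $\langle X,Y\rangle=\mathrm{Tr}(X^*Y)$, the quantum edge expansion is $$h_Q(\mathbf{B})=\min_{V\le\mathbb{C}^n,\ 1\le\dim V\le n/2}\frac{\langle I_n-P_V,\Phi_{\mathbf{B}}(P_V)\rangle}{\dim V}.$$ -}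

module Defs where

open import Algebra.Bundles.Raw using (RawMonoid)
import Algebra.Definitions.RawMonoid as RawMonoidDefs
open import Data.Bool.Base using (if_then_else_; _∧_)
open import Data.Fin.Base as Fin using (Fin)
import Data.Fin.Properties as Fin
open import Data.Fin.Subset using (Subset; ∣_∣) renaming (_∈_ to _∈ₛ_)
open import Data.Fin.Subset.Properties using () renaming (_∈?_ to _∈ₛ?_)
open import Data.Integer.Base as ℤ using (+_; +[1+_]; +<+)
import Data.Integer.Properties as ℤ
open import Data.List.Base as List using (List; length; filter; allFin; cartesianProduct)
open import Data.Nat.Base as ℕ using (ℕ; zero; suc)
import Data.Nat.Properties as ℕ
open import Data.Product.Base using (Σ; ∃; _×_; _,_; proj₁; proj₂; uncurry)
open import Data.Rational.Base as ℚ using (ℚ; 0ℚ; 1ℚ; ½; mkℚ; _/_; *<*)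
import Data.Rational.Properties as ℚ
import Data.Rational.Solver as ℚSolver
open import Data.Rational.Unnormalised.Base as ℚᵘ using (ℚᵘ; mkℚᵘ)
import Data.Rational.Unnormalised.Properties as ℚᵘ
open import Data.Sum.Base using (inj₁; inj₂)
open import Data.Vec.Functional using (Vector)
open import Function.Bundles using (_⇔_)
open import Level using (0ℓ) renaming (suc to lsuc)
open import Relation.Binary.Core using (Rel)
open import Relation.Binary.PropositionalEquality
  using (_≡_; _≢_; refl; sym; trans; cong; cong₂; subst; subst₂; ≢-sym)
open import Relation.Nullary.Decidable using (Dec; yes; no; ¬?; _×-dec_; does)
open import Relation.Nullary.Negation using (¬_)
open import Relation.Unary using (Pred)

IsMinimum : ∀ {a ℓ p} {A : Set a} → Rel A ℓ → Pred A p → A → Set _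
IsMinimum _≤_ S x = S x × (∀ y → S y → x ≤ y)

------------------------------------------------------------------------
-- Real numbers: Cauchy sequences of rationals, compared up to the
-- setoid equality _≈ᴿ_

Cauchy : (ℕ → ℚ) → Set
Cauchy s = ∀ ε → 0ℚ ℚ.< ε →
  ∃ λ N → ∀ m n → N ℕ.≤ m → N ℕ.≤ n → ℚ.∣ s m ℚ.- s n ∣ ℚ.< ε

record ℝ : Set where
  constructor mkℝ
  field
    seq    : ℕ → ℚ
    cauchy : Cauchy seq

open ℝ public

infix 4 _≈ᴿ_ _≤ᴿ_
infixl 6 _+ᴿ_
infixl 7 _*ᴿ_
infix 8 -ᴿ_

_≈ᴿ_ : Rel ℝ 0ℓ
x ≈ᴿ y = ∀ ε → 0ℚ ℚ.< ε → ∃ λ N → ∀ n → N ℕ.≤ n → ℚ.∣ seq x n ℚ.- seq y n ∣ ℚ.< ε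

_≤ᴿ_ : Rel ℝ 0ℓ
x ≤ᴿ y = ∀ ε → 0ℚ ℚ.< ε → ∃ λ N → ∀ n → N ℕ.≤ n → seq x n ℚ.< seq y n ℚ.+ ε

open ℚSolver.+-*-Solver using (_:+_; _:-_; _:*_; :-_; _:=_)
  renaming (solve to solveℚ)

-- Abstract only to keep type checking fast: only the sequences matter below.
abstract
  ½-pos : ∀ {ε} → 0ℚ ℚ.< ε → 0ℚ ℚ.< ½ ℚ.* ε
  ½-pos {ε} 0<ε = subst (ℚ._< ½ ℚ.* ε) (ℚ.*-zeroʳ ½) (ℚ.*-monoʳ-<-pos ½ 0<ε)

  ½+½ : ∀ ε → ½ ℚ.* ε ℚ.+ ½ ℚ.* ε ≡ ε
  ½+½ ε = trans (sym (ℚ.*-distribʳ-+ ε ½ ½)) (ℚ.*-identityˡ ε)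

  +-split : ∀ a b c d → (a ℚ.+ c) ℚ.- (b ℚ.+ d) ≡ (a ℚ.- b) ℚ.+ (c ℚ.- d)
  +-split = solveℚ 4 (λ a b c d → (a :+ c) :- (b :+ d) := (a :- b) :+ (c :- d)) refl

  neg-split : ∀ a b → (ℚ.- a) ℚ.- (ℚ.- b) ≡ ℚ.- (a ℚ.- b)
  neg-split = solveℚ 2 (λ a b → (:- a) :- (:- b) := :- (a :- b)) refl

  *-split : ∀ a b c d → (a ℚ.* c) ℚ.- (b ℚ.* d) ≡ a ℚ.* (c ℚ.- d) ℚ.+ (a ℚ.- b) ℚ.* d
  *-split = solveℚ 4 (λ a b c d → (a :* c) :- (b :* d) := a :* (c :- d) :+ (a :- b) :* d) refl

  +-sub : ∀ a b → (a ℚ.- b) ℚ.+ b ≡ a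
  +-sub = solveℚ 2 (λ a b → (a :- b) :+ b := a) refl

  +-sub′ : ∀ a b → (b ℚ.+ a) ℚ.- b ≡ a
  +-sub′ = solveℚ 2 (λ a b → (b :+ a) :- b := a) refl

  neg-sub : ∀ a b → ℚ.- (a ℚ.- b) ≡ b ℚ.- a
  neg-sub = solveℚ 2 (λ a b → :- (a :- b) := b :- a) refl

  bound : ∀ {s} → Cauchy s → ∃ λ B → ∃ λ N → 0ℚ ℚ.< B × (∀ n → N ℕ.≤ n → ℚ.∣ s n ∣ ℚ.≤ B)
  bound {s} cs with cs 1ℚ (*<* (+<+ (ℕ.s≤s ℕ.z≤n)))
  ... | N , h = 1ℚ ℚ.+ ℚ.∣ s N ∣ , N ,
    ℚ.+-mono-<-≤ {0ℚ} {1ℚ} {0ℚ} (*<* (+<+ (ℕ.s≤s ℕ.z≤n))) (ℚ.0≤∣p∣ (s N)) ,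
    λ n N≤n → ℚ.≤-trans
      (ℚ.≤-reflexive (cong ℚ.∣_∣ (sym (+-sub (s n) (s N)))))
      (ℚ.≤-trans (ℚ.∣p+q∣≤∣p∣+∣q∣ (s n ℚ.- s N) (s N))
        (ℚ.+-monoˡ-≤ ℚ.∣ s N ∣ (ℚ.<⇒≤ (h n N N≤n ℕ.≤-refl))))

  const-cauchy : ∀ p → Cauchy (λ _ → p)
  const-cauchy p ε 0<ε =
    0 , λ _ _ _ _ → subst (ℚ._< ε) (sym (cong ℚ.∣_∣ (ℚ.+-inverseʳ p))) 0<ε

  +-cauchy : ∀ {s t} → Cauchy s → Cauchy t → Cauchy (λ n → s n ℚ.+ t n)
  +-cauchy {s} {t} cs ct ε 0<ε =
    let (N , h) = cs (½ ℚ.* ε) (½-pos 0<ε)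
        (M , k) = ct (½ ℚ.* ε) (½-pos 0<ε)
    in N ℕ.⊔ M , λ m n p q →
       subst₂ ℚ._<_ (cong ℚ.∣_∣ (sym (+-split (s m) (s n) (t m) (t n)))) (½+½ ε)
         (ℚ.≤-<-trans (ℚ.∣p+q∣≤∣p∣+∣q∣ (s m ℚ.- s n) (t m ℚ.- t n))
           (ℚ.+-mono-< (h m n (ℕ.m⊔n≤o⇒m≤o N M p) (ℕ.m⊔n≤o⇒m≤o N M q))
                       (k m n (ℕ.m⊔n≤o⇒n≤o N M p) (ℕ.m⊔n≤o⇒n≤o N M q))))

  neg-cauchy : ∀ {s} → Cauchy s → Cauchy (λ n → ℚ.- s n)
  neg-cauchy {s} cs ε 0<ε =
    let (N , h) = cs ε 0<ε
    in N , λ m n p q →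
       subst (ℚ._< ε)
         (sym (trans (cong ℚ.∣_∣ (neg-split (s m) (s n))) (ℚ.∣-p∣≡∣p∣ (s m ℚ.- s n))))
         (h m n p q)

  δ-for : ∀ A B ε → 0ℚ ℚ.< A → 0ℚ ℚ.< B → 0ℚ ℚ.< ε →
          ∃ λ δ → 0ℚ ℚ.< δ × A ℚ.* δ ℚ.+ δ ℚ.* B ≡ ε
  δ-for A B ε 0<A 0<B 0<ε = go (A ℚ.+ B) refl (ℚ.+-mono-< {0ℚ} {A} {0ℚ} 0<A 0<B)
    where
    go : ∀ C → A ℚ.+ B ≡ C → 0ℚ ℚ.< C → ∃ λ δ → 0ℚ ℚ.< δ × A ℚ.* δ ℚ.+ δ ℚ.* B ≡ ε
    go C eq 0<C = ε ℚ.* i ,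
      subst (ℚ._< ε ℚ.* i) (ℚ.*-zeroˡ i) (ℚ.*-monoˡ-<-pos i {{ℚ.1/pos⇒pos C {{C-pos}}}} 0<ε) ,
      trans (solveℚ 4 (λ a b e i → a :* (e :* i) :+ (e :* i) :* b := e :* (i :* (a :+ b)))
              refl A B ε i)
        (trans (cong (λ c → ε ℚ.* (i ℚ.* c)) eq)
          (trans (cong (ε ℚ.*_) (ℚ.*-inverseˡ C {{C-nz}})) (ℚ.*-identityʳ ε)))
      where
      C-pos : ℚ.Positive C
      C-pos = ℚ.positive 0<C
      C-nz : ℚ.NonZero C
      C-nz = ℚ.pos⇒nonZero C {{C-pos}}
      i : ℚ
      i = ℚ.1/_ C {{C-nz}}

  ∣*∣-boundˡ : ∀ p q A δ → 0ℚ ℚ.< A → ℚ.∣ p ∣ ℚ.≤ A → ℚ.∣ q ∣ ℚ.< δ → ℚ.∣ p ℚ.* q ∣ ℚ.< A ℚ.* δ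
  ∣*∣-boundˡ p q A δ 0<A p≤A q<δ = subst (ℚ._< A ℚ.* δ) (sym (ℚ.∣p*q∣≡∣p∣*∣q∣ p q))
    (ℚ.≤-<-trans
      (ℚ.*-monoʳ-≤-nonNeg ℚ.∣ q ∣ {{ℚ.nonNegative (ℚ.0≤∣p∣ q)}} p≤A)
      (ℚ.*-monoʳ-<-pos A {{ℚ.positive 0<A}} q<δ))

  ∣*∣-boundʳ : ∀ p q δ B → 0ℚ ℚ.< B → ℚ.∣ p ∣ ℚ.< δ → ℚ.∣ q ∣ ℚ.≤ B → ℚ.∣ p ℚ.* q ∣ ℚ.< δ ℚ.* B
  ∣*∣-boundʳ p q δ B 0<B p<δ q≤B = subst₂ ℚ._<_ (cong ℚ.∣_∣ (ℚ.*-comm q p)) (ℚ.*-comm B δ)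
    (∣*∣-boundˡ q p B δ 0<B q≤B p<δ)

  *-close : ∀ u v r s A B δ ε → 0ℚ ℚ.< A → 0ℚ ℚ.< B → A ℚ.* δ ℚ.+ δ ℚ.* B ≡ ε →
            ℚ.∣ u ∣ ℚ.≤ A → ℚ.∣ s ∣ ℚ.≤ B → ℚ.∣ u ℚ.- v ∣ ℚ.< δ → ℚ.∣ r ℚ.- s ∣ ℚ.< δ →
            ℚ.∣ u ℚ.* r ℚ.- v ℚ.* s ∣ ℚ.< ε
  *-close u v r s A B δ ε 0<A 0<B total hu hs huv hrs =
    subst₂ ℚ._<_ (cong ℚ.∣_∣ (sym (*-split u v r s))) total
      (ℚ.≤-<-trans (ℚ.∣p+q∣≤∣p∣+∣q∣ (u ℚ.* (r ℚ.- s)) ((u ℚ.- v) ℚ.* s))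
        (ℚ.+-mono-<
          (∣*∣-boundˡ u (r ℚ.- s) A δ 0<A hu hrs)
          (∣*∣-boundʳ (u ℚ.- v) s δ B 0<B huv hs)))

  *-cauchy : ∀ {s t} → Cauchy s → Cauchy t → Cauchy (λ n → s n ℚ.* t n)
  *-cauchy {s} {t} cs ct ε 0<ε =
    let (A , N₁ , 0<A , hA) = bound {s} cs
        (B , N₂ , 0<B , hB) = bound {t} ct
        (δ , 0<δ , total)   = δ-for A B ε 0<A 0<B 0<ε
        (N₃ , hs)           = cs δ 0<δ
        (N₄ , ht)           = ct δ 0<δ
    in *-modulus A B δ N₁ N₂ N₃ N₄ 0<A 0<B total hA hB hs ht
    where
    *-modulus : ∀ A B δ N₁ N₂ N₃ N₄ → 0ℚ ℚ.< A → 0ℚ ℚ.< B → A ℚ.* δ ℚ.+ δ ℚ.* B ≡ ε →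
      (∀ n → N₁ ℕ.≤ n → ℚ.∣ s n ∣ ℚ.≤ A) → (∀ n → N₂ ℕ.≤ n → ℚ.∣ t n ∣ ℚ.≤ B) →
      (∀ m n → N₃ ℕ.≤ m → N₃ ℕ.≤ n → ℚ.∣ s m ℚ.- s n ∣ ℚ.< δ) →
      (∀ m n → N₄ ℕ.≤ m → N₄ ℕ.≤ n → ℚ.∣ t m ℚ.- t n ∣ ℚ.< δ) →
      ∃ λ N → ∀ m n → N ℕ.≤ m → N ℕ.≤ n → ℚ.∣ s m ℚ.* t m ℚ.- s n ℚ.* t n ∣ ℚ.< ε
    *-modulus A B δ N₁ N₂ N₃ N₄ 0<A 0<B total hA hB hs ht =
      (N₁ ℕ.⊔ N₂) ℕ.⊔ (N₃ ℕ.⊔ N₄) , λ m n p q →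
        *-close (s m) (s n) (t m) (t n) A B δ ε 0<A 0<B total
          (hA m (n₁ (n₁₂ p))) (hB n (n₂ (n₁₂ q)))
          (hs m n (n₃ (n₃₄ p)) (n₃ (n₃₄ q)))
          (ht m n (n₄ (n₃₄ p)) (n₄ (n₃₄ q)))
      where
      n₁₂ : ∀ {k} → (N₁ ℕ.⊔ N₂) ℕ.⊔ (N₃ ℕ.⊔ N₄) ℕ.≤ k → N₁ ℕ.⊔ N₂ ℕ.≤ k
      n₁₂ = ℕ.m⊔n≤o⇒m≤o (N₁ ℕ.⊔ N₂) (N₃ ℕ.⊔ N₄)
      n₃₄ : ∀ {k} → (N₁ ℕ.⊔ N₂) ℕ.⊔ (N₃ ℕ.⊔ N₄) ℕ.≤ k → N₃ ℕ.⊔ N₄ ℕ.≤ k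
      n₃₄ = ℕ.m⊔n≤o⇒n≤o (N₁ ℕ.⊔ N₂) (N₃ ℕ.⊔ N₄)
      n₁ : ∀ {k} → N₁ ℕ.⊔ N₂ ℕ.≤ k → N₁ ℕ.≤ k
      n₁ = ℕ.m⊔n≤o⇒m≤o N₁ N₂
      n₂ : ∀ {k} → N₁ ℕ.⊔ N₂ ℕ.≤ k → N₂ ℕ.≤ k
      n₂ = ℕ.m⊔n≤o⇒n≤o N₁ N₂
      n₃ : ∀ {k} → N₃ ℕ.⊔ N₄ ℕ.≤ k → N₃ ℕ.≤ k
      n₃ = ℕ.m⊔n≤o⇒m≤o N₃ N₄
      n₄ : ∀ {k} → N₃ ℕ.⊔ N₄ ℕ.≤ k → N₄ ℕ.≤ k
      n₄ = ℕ.m⊔n≤o⇒n≤o N₃ N₄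

fromℚ : ℚ → ℝ
fromℚ p = mkℝ (λ _ → p) (const-cauchy p)

_+ᴿ_ : ℝ → ℝ → ℝ
x +ᴿ y = mkℝ (λ n → seq x n ℚ.+ seq y n) (+-cauchy {seq x} {seq y} (cauchy x) (cauchy y))

-ᴿ_ : ℝ → ℝ
-ᴿ x = mkℝ (λ n → ℚ.- seq x n) (neg-cauchy {seq x} (cauchy x))

_*ᴿ_ : ℝ → ℝ → ℝ
x *ᴿ y = mkℝ (λ n → seq x n ℚ.* seq y n) (*-cauchy {seq x} {seq y} (cauchy x) (cauchy y))

-- The largest r with r * r ≤ n.
⌊√_⌋ : ℕ → ℕ
⌊√ zero ⌋  = zero
⌊√ suc n ⌋ with suc ⌊√ n ⌋ ℕ.* suc ⌊√ n ⌋ ℕ.≤? suc n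
... | yes _ = suc ⌊√ n ⌋
... | no  _ = ⌊√ n ⌋

-- The k-th approximation ⌊√(a (k+1)²)⌋ / (k+1) lies below √a by less than 1/(k+1).
√-num : ℕ → ℕ → ℕ
√-num a k = ⌊√ a ℕ.* (suc k ℕ.* suc k) ⌋

√-seq : ℕ → ℕ → ℚ
√-seq a k = + √-num a k / suc k

abstract
  ⌊√⌋-lower : ∀ n → ⌊√ n ⌋ ℕ.* ⌊√ n ⌋ ℕ.≤ n
  ⌊√⌋-lower zero = ℕ.z≤n
  ⌊√⌋-lower (suc n) with suc ⌊√ n ⌋ ℕ.* suc ⌊√ n ⌋ ℕ.≤? suc n
  ... | yes p = p
  ... | no  _ = ℕ.m≤n⇒m≤1+n (⌊√⌋-lower n)

  ⌊√⌋-upper : ∀ n → n ℕ.< suc ⌊√ n ⌋ ℕ.* suc ⌊√ n ⌋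
  ⌊√⌋-upper zero = ℕ.s≤s ℕ.z≤n
  ⌊√⌋-upper (suc n) with suc ⌊√ n ⌋ ℕ.* suc ⌊√ n ⌋ ℕ.≤? suc n
  ... | yes p = ℕ.≤-<-trans (⌊√⌋-upper n)
                  (ℕ.*-mono-< (ℕ.n<1+n (suc ⌊√ n ⌋)) (ℕ.n<1+n (suc ⌊√ n ⌋)))
  ... | no ¬p = ℕ.≰⇒> ¬p

  √-num-close : ∀ a m n → √-num a m ℕ.* suc n ℕ.< suc (√-num a n) ℕ.* suc m
  √-num-close a m n = ℕ.≰⇒> λ le → ℕ.<-irrefl refl (begin-strict
    (a ℕ.* (suc n ℕ.* suc n)) ℕ.* (suc m ℕ.* suc m) <⟨ ℕ.*-monoˡ-< (suc m ℕ.* suc m) (⌊√⌋-upper (a ℕ.* (suc n ℕ.* suc n))) ⟩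
    (suc s ℕ.* suc s) ℕ.* (suc m ℕ.* suc m)       ≡⟨ swap (suc s) (suc m) ⟩
    (suc s ℕ.* suc m) ℕ.* (suc s ℕ.* suc m)       ≤⟨ ℕ.*-mono-≤ le le ⟩
    (r ℕ.* suc n) ℕ.* (r ℕ.* suc n)               ≡⟨ swap r (suc n) ⟨
    (r ℕ.* r) ℕ.* (suc n ℕ.* suc n)               ≤⟨ ℕ.*-monoˡ-≤ (suc n ℕ.* suc n) (⌊√⌋-lower (a ℕ.* (suc m ℕ.* suc m))) ⟩
    (a ℕ.* (suc m ℕ.* suc m)) ℕ.* (suc n ℕ.* suc n) ≡⟨ swap′ a (suc m ℕ.* suc m) (suc n ℕ.* suc n) ⟩
    (a ℕ.* (suc n ℕ.* suc n)) ℕ.* (suc m ℕ.* suc m) ∎)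
    where
    open ℕ.≤-Reasoning
    r s : ℕ
    r = √-num a m
    s = √-num a n
    swap : ∀ x y → (x ℕ.* x) ℕ.* (y ℕ.* y) ≡ (x ℕ.* y) ℕ.* (x ℕ.* y)
    swap x y = ℕ.[m*n]*[o*p]≡[m*o]*[n*p] x x y y
    swap′ : ∀ x y z → (x ℕ.* y) ℕ.* z ≡ (x ℕ.* z) ℕ.* y
    swap′ x y z = trans (ℕ.*-assoc x y z) (trans (cong (x ℕ.*_) (ℕ.*-comm y z)) (sym (ℕ.*-assoc x z y)))

  √-seq-close : ∀ a m n → √-seq a m ℚ.- √-seq a n ℚ.< + 1 / suc n
  √-seq-close a m n = subst (√-seq a m ℚ.- √-seq a n ℚ.<_) (+-sub′ (+ 1 / suc n) (√-seq a n))
    (ℚ.+-monoˡ-< (ℚ.- √-seq a n) (ℚ.toℚᵘ-cancel-< step))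
    where
    u v w : ℚᵘ
    u = mkℚᵘ (+ √-num a m) m
    v = mkℚᵘ (+ √-num a n) n
    w = mkℚᵘ (+ 1) n
    v+w≃ : v ℚᵘ.+ w ℚᵘ.≃ mkℚᵘ (+ suc (√-num a n)) n
    v+w≃ = ℚᵘ.*≡* (trans
      (cong (ℤ._* + suc n) (sym (ℤ.*-distribʳ-+ (+ suc n) (+ √-num a n) (+ 1))))
      (trans (ℤ.*-assoc (+ √-num a n ℤ.+ + 1) (+ suc n) (+ suc n))
        (cong₂ ℤ._*_ {x = + √-num a n ℤ.+ + 1} {y = + suc (√-num a n)}
          (cong +_ (ℕ.+-comm (√-num a n) 1)) (sym (ℤ.pos-* (suc n) (suc n))))))
    u<v+w : u ℚᵘ.< v ℚᵘ.+ w
    u<v+w = ℚᵘ.<-respʳ-≃ (ℚᵘ.≃-sym {v ℚᵘ.+ w} {mkℚᵘ (+ suc (√-num a n)) n} v+w≃)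
      (ℚᵘ.*<* (subst₂ ℤ._<_ (ℤ.pos-* (√-num a m) (suc n)) (ℤ.pos-* (suc (√-num a n)) (suc m))
        (+<+ (√-num-close a m n))))
    step : ℚ.toℚᵘ (√-seq a m) ℚᵘ.< ℚ.toℚᵘ (√-seq a n ℚ.+ (+ 1 / suc n))
    step = ℚᵘ.<-respˡ-≃ (ℚᵘ.≃-sym (ℚ.toℚᵘ-fromℚᵘ u))
      (ℚᵘ.<-respʳ-≃
        (ℚᵘ.≃-sym (ℚᵘ.≃-trans (ℚ.toℚᵘ-homo-+ (√-seq a n) (+ 1 / suc n))
          (ℚᵘ.+-cong (ℚ.toℚᵘ-fromℚᵘ v) (ℚ.toℚᵘ-fromℚᵘ w))))
        u<v+w)

  archimedean : ∀ ε → 0ℚ ℚ.< ε → ∃ λ N → ∀ n → N ℕ.≤ n → + 1 / suc n ℚ.< ε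
  archimedean (mkℚ (+ zero) d c) (*<* (+<+ ()))
  archimedean (mkℚ +[1+ p ] d c) _ = suc d , λ n N≤n →
    ℚ.toℚᵘ-cancel-< (ℚᵘ.<-respˡ-≃ (ℚᵘ.≃-sym (ℚ.toℚᵘ-fromℚᵘ (mkℚᵘ (+ 1) n)))
      (ℚᵘ.*<* (subst₂ ℤ._<_ (ℤ.pos-* 1 (suc d)) (ℤ.pos-* (suc p) (suc n))
        (+<+ (subst (ℕ._< suc p ℕ.* suc n) (sym (ℕ.*-identityˡ (suc d)))
          (ℕ.<-≤-trans (ℕ.s≤s N≤n) (ℕ.m≤n*m (suc n) (suc p))))))))

  ∣∣-intro : ∀ p ε → p ℚ.< ε → ℚ.- p ℚ.< ε → ℚ.∣ p ∣ ℚ.< ε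
  ∣∣-intro p ε p<ε -p<ε with ℚ.∣p∣≡p∨∣p∣≡-p p
  ... | inj₁ eq = subst (ℚ._< ε) (sym eq) p<ε
  ... | inj₂ eq = subst (ℚ._< ε) (sym eq) -p<ε

  √-cauchy : ∀ a → Cauchy (√-seq a)
  √-cauchy a ε 0<ε =
    let (N , h) = archimedean ε 0<ε
    in N , λ m n N≤m N≤n →
       ∣∣-intro (√-seq a m ℚ.- √-seq a n) ε
         (ℚ.<-trans (√-seq-close a m n) (h n N≤n))
         (subst (ℚ._< ε) (sym (neg-sub (√-seq a m) (√-seq a n)))
           (ℚ.<-trans (√-seq-close a n m) (h m N≤m)))

√ᴿ_ : ℕ → ℝ
√ᴿ a = mkℝ (√-seq a) (√-cauchy a)

------------------------------------------------------------------------
-- Complex numbers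

infix 4 _+i_

record ℂ : Set where
  constructor _+i_
  field
    re im : ℝ

open ℂ public

infix 4 _≈ᶜ_
infixl 6 _+ᶜ_ _-ᶜ_
infixl 7 _*ᶜ_
infix 8 -ᶜ_

_≈ᶜ_ : Rel ℂ 0ℓ
z ≈ᶜ w = re z ≈ᴿ re w × im z ≈ᴿ im w

fromℝ : ℝ → ℂ
fromℝ x = x +i fromℚ 0ℚ

0ᶜ 1ᶜ : ℂ
0ᶜ = fromℝ (fromℚ 0ℚ)
1ᶜ = fromℝ (fromℚ 1ℚ)

-ᶜ_ conj : ℂ → ℂ
-ᶜ z   = (-ᴿ re z) +i (-ᴿ im z)
conj z = re z +i (-ᴿ im z)

_+ᶜ_ _*ᶜ_ : ℂ → ℂ → ℂ
z +ᶜ w = (re z +ᴿ re w) +i (im z +ᴿ im w)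
z *ᶜ w = (re z *ᴿ re w +ᴿ -ᴿ (im z *ᴿ im w)) +i (re z *ᴿ im w +ᴿ im z *ᴿ re w)

_-ᶜ_ : ℂ → ℂ → ℂ
z -ᶜ w = z +ᶜ (-ᶜ w)

+ᶜ-rawMonoid : RawMonoid 0ℓ 0ℓ
+ᶜ-rawMonoid = record { Carrier = ℂ ; _≈_ = _≈ᶜ_ ; _∙_ = _+ᶜ_ ; ε = 0ᶜ }

open RawMonoidDefs +ᶜ-rawMonoid public using () renaming (sum to ∑)

------------------------------------------------------------------------
-- Vectors and matrices

infix 4 _≈ᵛ_ _≈ᵐ_
infixl 6 _-ᵐ_
infixl 7 _*ᵐ_ _*ᵐᵛ_
infix 9 _ᴴ

_≈ᵛ_ : ∀ {n} → Rel (Vector ℂ n) 0ℓ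
x ≈ᵛ y = ∀ i → x i ≈ᶜ y i

linearCombination : ∀ {n d} → Vector ℂ d → Vector (Vector ℂ n) d → Vector ℂ n
linearCombination c b i = ∑ λ k → c k *ᶜ b k i

-- M(n,ℂ), as A i j with row index i and column index j.
Matrix : ℕ → Set
Matrix n = Vector (Vector ℂ n) n

_≈ᵐ_ : ∀ {n} → Rel (Matrix n) 0ℓ
A ≈ᵐ B = ∀ i j → A i j ≈ᶜ B i j

unit : ∀ {n} → Fin n → Fin n → Matrix n
unit i j k l = if does (i Fin.≟ k) ∧ does (j Fin.≟ l) then 1ᶜ else 0ᶜ

1ᵐ : ∀ {n} → Matrix n
1ᵐ i j = if does (i Fin.≟ j) then 1ᶜ else 0ᶜ

_-ᵐ_ _*ᵐ_ : ∀ {n} → Matrix n → Matrix n → Matrix n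
(A -ᵐ B) i j = A i j -ᶜ B i j
(A *ᵐ B) i j = ∑ λ k → A i k *ᶜ B k j

_•_ : ∀ {n} → ℂ → Matrix n → Matrix n
(c • A) i j = c *ᶜ A i j

∑ᵐ : ∀ {n m} → Vector (Matrix n) m → Matrix n
∑ᵐ A i j = ∑ λ k → A k i j

_ᴴ : ∀ {n} → Matrix n → Matrix n
(A ᴴ) i j = conj (A j i)

_*ᵐᵛ_ : ∀ {n} → Matrix n → Vector ℂ n → Vector ℂ n
(A *ᵐᵛ x) i = ∑ λ j → A i j *ᶜ x j

Tr : ∀ {n} → Matrix n → ℂ
Tr A = ∑ λ i → A i i

⟨_,_⟩ : ∀ {n} → Matrix n → Matrix n → ℂ
⟨ X , Y ⟩ = Tr (X ᴴ *ᵐ Y)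

record Subspace (n : ℕ) : Set₁ where
  field
    _∈V      : Pred (Vector ℂ n) 0ℓ
    ∈-resp-≈ : ∀ {x y} → x ≈ᵛ y → x ∈V → y ∈V
    0-closed : (λ _ → 0ᶜ) ∈V
    +-closed : ∀ {x y} → x ∈V → y ∈V → (λ i → x i +ᶜ y i) ∈V
    *-closed : ∀ c {x} → x ∈V → (λ i → c *ᶜ x i) ∈V

record HasDimension {n} (V : Subspace n) (d : ℕ) : Set where
  open Subspace V
  field
    basis       : Vector (Vector ℂ n) d
    basis∈V     : ∀ k → basis k ∈V
    independent : ∀ c → linearCombination c basis ≈ᵛ (λ _ → 0ᶜ) → ∀ k → c k ≈ᶜ 0ᶜ
    spanning    : ∀ {x} → x ∈V → ∃ λ c → x ≈ᵛ linearCombination c basis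

record IsOrthogonalProjection {n} (P : Matrix n) (V : Subspace n) : Set where
  open Subspace V
  field
    selfAdjoint : P ᴴ ≈ᵐ P
    idempotent  : P *ᵐ P ≈ᵐ P
    range       : ∀ x → x ∈V ⇔ (∃ λ y → x ≈ᵛ P *ᵐᵛ y)

------------------------------------------------------------------------
-- Graphs and edge expansion

record Graph (n : ℕ) : Set₁ where
  field
    Adj        : Rel (Fin n) 0ℓ
    adj?       : ∀ i j → Dec (Adj i j)
    adj-sym    : ∀ {i j} → Adj i j → Adj j i
    adj-irrefl : ∀ {i} → ¬ Adj i i

  -- The ordered pairs (i , j) with {i , j} an edge.
  arcs : List (Fin n × Fin n)
  arcs = filter (uncurry adj?) (cartesianProduct (allFin n) (allFin n))

  degree : Fin n → ℕ
  degree i = length (filter (adj? i) (allFin n))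

  -- Each edge {i , j} of the boundary of W is represented exactly once,
  -- oriented so that i ∈ W and j ∉ W.
  ∂ : Subset n → List (Fin n × Fin n)
  ∂ W = filter (λ (i , j) → (i ∈ₛ? W) ×-dec ¬? (j ∈ₛ? W)) arcs

record RegularGraph (n d : ℕ) : Set₁ where
  field
    graph   : Graph n
    regular : ∀ i → Graph.degree graph i ≡ d

  open Graph graph public

EdgeCutValue : ∀ {n d} .{{_ : ℕ.NonZero d}} → RegularGraph n d → Pred ℚ 0ℓ
EdgeCutValue {n} {d} {{d≢0}} G h =
  Σ (Subset n) λ W → Σ (1 ℕ.≤ ∣ W ∣) λ 1≤∣W∣ → 2 ℕ.* ∣ W ∣ ℕ.≤ n ×
    h ≡ (+ length (RegularGraph.∂ G W) / (d ℕ.* ∣ W ∣))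
          {{ℕ.m*n≢0 d ∣ W ∣ {{d≢0}} {{ℕ.>-nonZero 1≤∣W∣}}}}

-- h is the edge expansion of G.
IsEdgeExpansion : ∀ {n d} .{{_ : ℕ.NonZero d}} → RegularGraph n d → ℚ → Set
IsEdgeExpansion G = IsMinimum ℚ._≤_ (EdgeCutValue G)

K₂ : RegularGraph 2 1
K₂ = record
  { graph = record
    { Adj        = _≢_
    ; adj?       = λ i j → ¬? (i Fin.≟ j)
    ; adj-sym    = ≢-sym
    ; adj-irrefl = λ i≢i → i≢i refl
    }
  ; regular = λ { Fin.zero → refl ; (Fin.suc Fin.zero) → refl }
  }

------------------------------------------------------------------------
-- Matrix tuples and quantum edge expansion

graphicalTuple : ∀ {n} (G : Graph n) → Vector (Matrix n) (length (Graph.arcs G))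
graphicalTuple {n} G k = let (i , j) = List.lookup (Graph.arcs G) k in
  fromℝ (√ᴿ n) • unit i j

DoublyStochastic : ∀ {n m} → Vector (Matrix n) m → Set
DoublyStochastic {n} {m} B =
  ∑ᵐ (λ k → B k *ᵐ B k ᴴ) ≈ᵐ m∙1 × ∑ᵐ (λ k → B k ᴴ *ᵐ B k) ≈ᵐ m∙1
  where
  m∙1 : Matrix n
  m∙1 = fromℝ (fromℚ (+ m / 1)) • 1ᵐ

Φ : ∀ {n m} .{{_ : ℕ.NonZero m}} → Vector (Matrix n) m → Matrix n → Matrix n
Φ {m = m} B X = fromℝ (fromℚ (+ 1 / m)) • ∑ᵐ (λ k → B k *ᵐ X *ᵐ B k ᴴ)

-- The quotient is always real; it is compared with q inside ℂ.
QuantumCutValue : ∀ {n m} .{{_ : ℕ.NonZero m}} → Vector (Matrix n) m → Pred ℝ (lsuc 0ℓ)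
QuantumCutValue {n} B q =
  Σ (Subspace n) λ V → Σ ℕ λ d → Σ (Matrix n) λ P →
    HasDimension V d × IsOrthogonalProjection P V ×
    Σ (1 ℕ.≤ d) λ 1≤d → 2 ℕ.* d ℕ.≤ n ×
    fromℝ q ≈ᶜ fromℝ (fromℚ ((+ 1 / d) {{ℕ.>-nonZero 1≤d}})) *ᶜ ⟨ 1ᵐ -ᵐ P , Φ B P ⟩

-- q is the quantum edge expansion of B, which is defined only when B is
-- doubly stochastic; in particular the minimum is attained.
IsQuantumEdgeExpansion : ∀ {n m} .{{_ : ℕ.NonZero m}} → Vector (Matrix n) m → Pred ℝ (lsuc 0ℓ)
IsQuantumEdgeExpansion B q = DoublyStochastic B × IsMinimum _≤ᴿ_ (QuantumCutValue B) q

{-# OPTIONS --safe #-}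
module Submission where

-- Writing a and b for the diagonal entries of an orthogonal projection P of rank one
-- on ℂ², Φ(P) = diag(b , a), so the cut value of P is (1 − a) b + (1 − b) a.  Since
-- a + b = Tr P = 1, this equals ½ + ½ (a − b)² ≥ ½, with equality for the projection
-- onto the span of (1 , 1).  Hence the quantum edge expansion is exactly ½.

open import Defs
open import Data.Product.Base using (_×_; ∃)
open import Data.Rational.Base using (1ℚ; ½)

open import Algebra.Bundles using (CommutativeRing)
import Algebra.Properties.Group as GroupProperties
import Algebra.Properties.Ring as RingProperties
import Algebra.Properties.Semiring.Sum as SemiringSum
import Algebra.Solver.Ring.NaturalCoefficients.Default as SemiringSolver
open import Data.Bool.Base using (Bool; true; false; if_then_else_; _∧_)
open import Data.Bool.Properties using (∧-comm; ∧-identityʳ)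
open import Data.Fin.Base using (Fin; zero; suc)
import Data.Fin.Properties as Fin
open import Data.Fin.Subset using (inside; outside)
open import Data.Integer.Base as ℤ using (+_; +≤+; +<+)
import Data.Integer.Properties as ℤ
open import Data.List.Base as List using ()
open import Data.Nat.Base as ℕ using (ℕ; suc; s≤s; z≤n)
import Data.Nat.Properties as ℕ
open import Data.Product.Base using (_,_; proj₁; proj₂)
open import Data.Rational.Base as ℚ using (ℚ; 0ℚ; _/_; *<*)
import Data.Rational.Properties as ℚ
import Data.Rational.Solver as ℚSolver
open import Data.Rational.Unnormalised.Base as ℚᵘ using (mkℚᵘ)
import Data.Rational.Unnormalised.Properties as ℚᵘ
open import Data.Sum.Base using (inj₁; inj₂)
open import Data.Vec.Base using ([]; _∷_)
open import Data.Vec.Functional using (Vector)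
open import Function.Base using (_∘_)
open import Function.Bundles using (Equivalence; mk⇔)
open import Relation.Binary.PropositionalEquality
  using (_≡_; refl; sym; trans; cong; cong₂; subst; subst₂)
import Relation.Binary.Reasoning.Setoid as SetoidReasoning
open import Relation.Nullary.Decidable using (does; dec-true; does-⇔)
open import Relation.Nullary.Negation using (contradiction)

open ℚSolver.+-*-Solver using (con; _:+_; _:-_; _:*_; :-_; _:=_) renaming (solve to solveℚ)

-- Real numbers

-- The operations act termwise, so the ring laws reduce through this to rational identities at each
-- index; moduli enter only for congruence and limits.
≗⇒≈ᴿ : ∀ {x y} → (∀ n → seq x n ≡ seq y n) → x ≈ᴿ y
≗⇒≈ᴿ {x} {y} eq ε 0<ε = 0 , λ n _ →
  subst (ℚ._< ε)
    (sym (cong ℚ.∣_∣ (trans (cong (ℚ._- seq y n) (eq n)) (ℚ.+-inverseʳ (seq y n))))) 0<ε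

≈ᴿ-sym : ∀ {x y} → x ≈ᴿ y → y ≈ᴿ x
≈ᴿ-sym {x} {y} p ε 0<ε = let (N , h) = p ε 0<ε in N , λ n N≤n →
  subst (ℚ._< ε) (trans (sym (ℚ.∣-p∣≡∣p∣ _)) (cong ℚ.∣_∣ (neg-sub (seq x n) (seq y n)))) (h n N≤n)

+ᴿ-cong : ∀ {x y u v} → x ≈ᴿ y → u ≈ᴿ v → x +ᴿ u ≈ᴿ y +ᴿ v
+ᴿ-cong {x} {y} {u} {v} p q ε 0<ε =
  let (N , h) = p (½ ℚ.* ε) (½-pos 0<ε)
      (M , k) = q (½ ℚ.* ε) (½-pos 0<ε)
  in N ℕ.⊔ M , λ n le →
     subst₂ ℚ._<_ (cong ℚ.∣_∣ (sym (+-split (seq x n) (seq y n) (seq u n) (seq v n)))) (½+½ ε)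
       (ℚ.≤-<-trans (ℚ.∣p+q∣≤∣p∣+∣q∣ (seq x n ℚ.- seq y n) (seq u n ℚ.- seq v n))
         (ℚ.+-mono-< (h n (ℕ.m⊔n≤o⇒m≤o N M le)) (k n (ℕ.m⊔n≤o⇒n≤o N M le))))

-- Adding x ≈ y and y ≈ z reuses the ε/2 argument of `+ᴿ-cong`, as (x + y) - (y + z) = x - z.
≈ᴿ-trans : ∀ {x y z} → x ≈ᴿ y → y ≈ᴿ z → x ≈ᴿ z
≈ᴿ-trans {x} {y} {z} p q ε 0<ε =
  let (N , h) = +ᴿ-cong {x} {y} {y} {z} p q ε 0<ε
  in N , λ n le → subst (ℚ._< ε)
       (cong ℚ.∣_∣ (solveℚ 3 (λ a b c → (a :+ b) :- (b :+ c) := a :- c) refl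
         (seq x n) (seq y n) (seq z n)))
       (h n le)

-ᴿ-cong : ∀ {x y} → x ≈ᴿ y → -ᴿ x ≈ᴿ -ᴿ y
-ᴿ-cong {x} {y} p ε 0<ε = let (N , h) = p ε 0<ε in N , λ n N≤n →
  subst (ℚ._< ε)
    (sym (trans (cong ℚ.∣_∣ (neg-split (seq x n) (seq y n))) (ℚ.∣-p∣≡∣p∣ (seq x n ℚ.- seq y n))))
    (h n N≤n)

-- As xu - yv = x(u - v) + (x - y)v, bounds on x and v suffice; `δ` is chosen with Aδ + δB = ε.
*ᴿ-cong : ∀ {x y u v} → x ≈ᴿ y → u ≈ᴿ v → x *ᴿ u ≈ᴿ y *ᴿ v
*ᴿ-cong {x} {y} {u} {v} p q ε 0<ε =
  let (A , N₁ , 0<A , hA) = bound {seq x} (cauchy x)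
      (B , N₂ , 0<B , hB) = bound {seq v} (cauchy v)
      (δ , 0<δ , total)   = δ-for A B ε 0<A 0<B 0<ε
      (N₃ , hp)           = p δ 0<δ
      (N₄ , hq)           = q δ 0<δ
  in (N₁ ℕ.⊔ N₂) ℕ.⊔ (N₃ ℕ.⊔ N₄) , λ n le →
     let le₁₂ = ℕ.m⊔n≤o⇒m≤o (N₁ ℕ.⊔ N₂) (N₃ ℕ.⊔ N₄) le
         le₃₄ = ℕ.m⊔n≤o⇒n≤o (N₁ ℕ.⊔ N₂) (N₃ ℕ.⊔ N₄) le
     in *-close (seq x n) (seq y n) (seq u n) (seq v n) A B δ ε 0<A 0<B total
          (hA n (ℕ.m⊔n≤o⇒m≤o N₁ N₂ le₁₂)) (hB n (ℕ.m⊔n≤o⇒n≤o N₁ N₂ le₁₂))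
          (hp n (ℕ.m⊔n≤o⇒m≤o N₃ N₄ le₃₄)) (hq n (ℕ.m⊔n≤o⇒n≤o N₃ N₄ le₃₄))

p≤∣p∣ : ∀ p → p ℚ.≤ ℚ.∣ p ∣
p≤∣p∣ p with ℚ.≤-total 0ℚ p
... | inj₁ 0≤p = ℚ.≤-reflexive (sym (ℚ.0≤p⇒∣p∣≡p 0≤p))
... | inj₂ p≤0 = ℚ.≤-trans p≤0 (ℚ.0≤∣p∣ p)

0≤p² : ∀ p → 0ℚ ℚ.≤ p ℚ.* p
0≤p² p = subst (0ℚ ℚ.≤_) ∣p∣²≡p²
  (ℚ.nonNegative⁻¹ (ℚ.∣ p ∣ ℚ.* ℚ.∣ p ∣) {{ℚ.nonNeg*nonNeg⇒nonNeg ℚ.∣ p ∣ {{∣p∣≥0}} ℚ.∣ p ∣ {{∣p∣≥0}}}})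
  where
  ∣p∣≥0 : ℚ.NonNegative ℚ.∣ p ∣
  ∣p∣≥0 = ℚ.nonNegative (ℚ.0≤∣p∣ p)
  ∣p∣²≡p² : ℚ.∣ p ∣ ℚ.* ℚ.∣ p ∣ ≡ p ℚ.* p
  ∣p∣²≡p² with ℚ.∣p∣≡p∨∣p∣≡-p p
  ... | inj₁ eq = cong₂ ℚ._*_ eq eq
  ... | inj₂ eq = trans (cong₂ ℚ._*_ eq eq) (solveℚ 1 (λ a → (:- a) :* (:- a) := a :* a) refl p)

-- The slack ε in `_≤ᴿ_` absorbs the distance between x and y, so a termwise bound on any
-- representative of the same real is enough.
≤ᴿ-of-≈-≥ : ∀ {p x y} → x ≈ᴿ y → (∀ n → p ℚ.≤ seq y n) → fromℚ p ≤ᴿ x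
≤ᴿ-of-≈-≥ {p} {x} {y} x≈y p≤y ε 0<ε =
  let (N , h) = ≈ᴿ-sym {x} {y} x≈y ε 0<ε
  in N , λ n N≤n → ℚ.≤-<-trans (p≤y n)
       (subst₂ ℚ._<_ (+-sub (seq y n) (seq x n)) (ℚ.+-comm ε (seq x n))
         (ℚ.+-monoˡ-< (seq x n) (ℚ.≤-<-trans (p≤∣p∣ (seq y n ℚ.- seq x n)) (h n N≤n))))

-- Squares of the rational approximations to √a

private
  toℚᵘ-sq : ∀ r k → ℚ.toℚᵘ ((+ r / suc k) ℚ.* (+ r / suc k)) ℚᵘ.≃ mkℚᵘ (+ r) k ℚᵘ.* mkℚᵘ (+ r) k
  toℚᵘ-sq r k = ℚᵘ.≃-trans (ℚ.toℚᵘ-homo-* (+ r / suc k) (+ r / suc k))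
    (ℚᵘ.*-cong (ℚ.toℚᵘ-fromℚᵘ (mkℚᵘ (+ r) k)) (ℚ.toℚᵘ-fromℚᵘ (mkℚᵘ (+ r) k)))

-- `_/_` reduces to lowest terms; in `ℚᵘ` the denominators stay visible, and cross-multiplying gives
-- the hypothesis up to a factor 1.
/-sq-≤ : ∀ r k a → r ℕ.* r ℕ.≤ a ℕ.* (suc k ℕ.* suc k) →
  (+ r / suc k) ℚ.* (+ r / suc k) ℚ.≤ + a / 1
/-sq-≤ r k a le = ℚ.toℚᵘ-cancel-≤
  (ℚᵘ.≤-respˡ-≃ (ℚᵘ.≃-sym (toℚᵘ-sq r k))
    (ℚᵘ.≤-respʳ-≃ (ℚᵘ.≃-sym (ℚ.toℚᵘ-fromℚᵘ (mkℚᵘ (+ a) 0)))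
      (ℚᵘ.*≤* (subst₂ ℤ._≤_
        (trans (ℤ.pos-* r r) (sym (ℤ.*-identityʳ (+ r ℤ.* + r))))
        (ℤ.pos-* a (suc k ℕ.* suc k)) (+≤+ le)))))

/-sq-> : ∀ r k a → a ℕ.* (suc k ℕ.* suc k) ℕ.< r ℕ.* r →
  + a / 1 ℚ.< (+ r / suc k) ℚ.* (+ r / suc k)
/-sq-> r k a lt = ℚ.toℚᵘ-cancel-<
  (ℚᵘ.<-respʳ-≃ (ℚᵘ.≃-sym (toℚᵘ-sq r k))
    (ℚᵘ.<-respˡ-≃ (ℚᵘ.≃-sym (ℚ.toℚᵘ-fromℚᵘ (mkℚᵘ (+ a) 0)))
      (ℚᵘ.*<* (subst₂ ℤ._<_
        (ℤ.pos-* a (suc k ℕ.* suc k))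
        (trans (ℤ.pos-* r r) (sym (ℤ.*-identityʳ (+ r ℤ.* + r)))) (+<+ lt)))))

suc-/ : ∀ r k → + suc r / suc k ≡ + r / suc k ℚ.+ + 1 / suc k
suc-/ r k = ℚ.toℚᵘ-injective (ℚᵘ.≃-trans (ℚ.toℚᵘ-fromℚᵘ (mkℚᵘ (+ suc r) k))
  (ℚᵘ.≃-sym (ℚᵘ.≃-trans (ℚ.toℚᵘ-homo-+ (+ r / suc k) (+ 1 / suc k))
    (ℚᵘ.≃-trans (ℚᵘ.+-cong (ℚ.toℚᵘ-fromℚᵘ (mkℚᵘ (+ r) k)) (ℚ.toℚᵘ-fromℚᵘ (mkℚᵘ (+ 1) k)))
      (ℚᵘ.*≡* (trans
        (cong (ℤ._* + suc k) (sym (ℤ.*-distribʳ-+ (+ suc k) (+ r) (+ 1))))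
        (trans (ℤ.*-assoc (+ r ℤ.+ + 1) (+ suc k) (+ suc k))
          (cong₂ ℤ._*_ {x = + r ℤ.+ + 1} {y = + suc r}
            (cong +_ (ℕ.+-comm r 1)) (sym (ℤ.pos-* (suc k) (suc k)))))))))))

-- With s = √-seq a n and d = 1/(n+1) we have s² ≤ a < (s + d)², so it suffices
-- that squaring is continuous on the bounded range of √-seq a.
√ᴿ-sq : ∀ a → √ᴿ a *ᴿ √ᴿ a ≈ᴿ fromℚ (+ a / 1)
√ᴿ-sq a ε 0<ε =
  let (B , N₁ , 0<B , hB) = bound {√-seq a} (√-cauchy a)
      0<B+1               = ℚ.+-mono-< {0ℚ} {B} {0ℚ} 0<B 0<1
      -- `B ℚ.+ 1ℚ` is the bound for s + d, because d < 1 beyond `N₂`; `B` is the bound for s.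
      (δ , 0<δ , total)   = δ-for (B ℚ.+ 1ℚ) B ε 0<B+1 0<B 0<ε
      (N₂ , h₁)           = archimedean 1ℚ 0<1
      (N₃ , hδ)           = archimedean δ 0<δ
  in N₁ ℕ.⊔ (N₂ ℕ.⊔ N₃) , λ n le →
     let le₂₃ = ℕ.m⊔n≤o⇒n≤o N₁ (N₂ ℕ.⊔ N₃) le
         s    = √-seq a n
         d    = + 1 / suc n
         s≤B  = hB n (ℕ.m⊔n≤o⇒m≤o N₁ (N₂ ℕ.⊔ N₃) le)
         d≥0  = ℚ.0≤p⇒∣p∣≡p (ℚ.nonNegative⁻¹ d {{ℚ.normalize-nonNeg 1 (suc n)}})
         d<1  = subst (ℚ._< 1ℚ) (sym d≥0) (h₁ n (ℕ.m⊔n≤o⇒m≤o N₂ N₃ le₂₃))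
         d<δ  = subst (ℚ._< δ) (trans (sym d≥0) (cong ℚ.∣_∣ (sym (+-sub′ d s))))
                  (hδ n (ℕ.m⊔n≤o⇒n≤o N₂ N₃ le₂₃))
         s+d  = ℚ.≤-trans (ℚ.∣p+q∣≤∣p∣+∣q∣ s d) (ℚ.+-mono-≤ s≤B (ℚ.<⇒≤ d<1))
     in close s (+ a / 1) (s ℚ.+ d)
          (/-sq-≤ (√-num a n) n a (⌊√⌋-lower (a ℕ.* (suc n ℕ.* suc n))))
          (subst (λ t → + a / 1 ℚ.< t ℚ.* t) (suc-/ (√-num a n) n)
            (/-sq-> (suc (√-num a n)) n a (⌊√⌋-upper (a ℕ.* (suc n ℕ.* suc n)))))
          (*-close (s ℚ.+ d) s (s ℚ.+ d) s (B ℚ.+ 1ℚ) B δ ε 0<B+1 0<B total s+d s≤B d<δ d<δ)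
  where
  0<1 : 0ℚ ℚ.< 1ℚ
  0<1 = *<* (+<+ (s≤s z≤n))
  close : ∀ s a t → s ℚ.* s ℚ.≤ a → a ℚ.< t ℚ.* t → ℚ.∣ t ℚ.* t ℚ.- s ℚ.* s ∣ ℚ.< ε →
          ℚ.∣ s ℚ.* s ℚ.- a ∣ ℚ.< ε
  close s a t s²≤a a<t² t²-s²<ε = ∣∣-intro (s ℚ.* s ℚ.- a) ε
    (ℚ.≤-<-trans (ℚ.+-monoˡ-≤ (ℚ.- a) s²≤a) (subst (ℚ._< ε) (sym (ℚ.+-inverseʳ a)) 0<ε))
    (subst (ℚ._< ε) (sym (neg-sub (s ℚ.* s) a))
      (ℚ.<-trans (ℚ.+-monoˡ-< (ℚ.- (s ℚ.* s)) a<t²)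
        (ℚ.≤-<-trans (p≤∣p∣ (t ℚ.* t ℚ.- s ℚ.* s)) t²-s²<ε)))

-- Complex numbers

infix 4 _≃_

-- A wrapper around _≈ᶜ_, which unfolds during unification and hence does not
-- determine its two sides.
record _≃_ (z w : ℂ) : Set where
  constructor equal
  field
    equality : z ≈ᶜ w

open _≃_

≗⇒≃ : ∀ {z w} → (∀ n → seq (re z) n ≡ seq (re w) n) → (∀ n → seq (im z) n ≡ seq (im w) n) → z ≃ w
≗⇒≃ {z} {w} p q = equal (≗⇒≈ᴿ {re z} {re w} p , ≗⇒≈ᴿ {im z} {im w} q)

≃-refl : ∀ {z} → z ≃ z
≃-refl = ≗⇒≃ (λ _ → refl) (λ _ → refl)

≃-sym : ∀ {z w} → z ≃ w → w ≃ z
≃-sym {z} {w} (equal (p , q)) = equal (≈ᴿ-sym {re z} {re w} p , ≈ᴿ-sym {im z} {im w} q)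

≃-trans : ∀ {z w v} → z ≃ w → w ≃ v → z ≃ v
≃-trans {z} {w} {v} (equal (p , q)) (equal (p′ , q′)) =
  equal (≈ᴿ-trans {re z} {re w} {re v} p p′ , ≈ᴿ-trans {im z} {im w} {im v} q q′)

+ᶜ-cong : ∀ {z w z′ w′} → z ≃ w → z′ ≃ w′ → z +ᶜ z′ ≃ w +ᶜ w′
+ᶜ-cong {z} {w} {z′} {w′} (equal (p , q)) (equal (p′ , q′)) =
  equal (+ᴿ-cong {re z} {re w} {re z′} {re w′} p p′ , +ᴿ-cong {im z} {im w} {im z′} {im w′} q q′)

-ᶜ-cong : ∀ {z w} → z ≃ w → -ᶜ z ≃ -ᶜ w
-ᶜ-cong {z} {w} (equal (p , q)) = equal (-ᴿ-cong {re z} {re w} p , -ᴿ-cong {im z} {im w} q)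

*ᶜ-cong : ∀ {z w z′ w′} → z ≃ w → z′ ≃ w′ → z *ᶜ z′ ≃ w *ᶜ w′
*ᶜ-cong {a +i b} {c +i d} {e +i f} {g +i h} (equal (p , q)) (equal (p′ , q′)) = equal
  ( +ᴿ-cong {a *ᴿ e} {c *ᴿ g} { -ᴿ (b *ᴿ f)} { -ᴿ (d *ᴿ h)}
      (*ᴿ-cong {a} {c} {e} {g} p p′)
      (-ᴿ-cong {b *ᴿ f} {d *ᴿ h} (*ᴿ-cong {b} {d} {f} {h} q q′))
  , +ᴿ-cong {a *ᴿ f} {c *ᴿ h} {b *ᴿ e} {d *ᴿ g}
      (*ᴿ-cong {a} {c} {f} {h} p q′) (*ᴿ-cong {b} {d} {e} {g} q p′) )

*ᶜ-assoc : ∀ x y z → (x *ᶜ y) *ᶜ z ≃ x *ᶜ (y *ᶜ z)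
*ᶜ-assoc (a +i b) (c +i d) (e +i f) = ≗⇒≃
  (λ n → solveℚ 6 (λ a b c d e f →
      (a :* c :+ :- (b :* d)) :* e :+ :- ((a :* d :+ b :* c) :* f) :=
      a :* (c :* e :+ :- (d :* f)) :+ :- (b :* (c :* f :+ d :* e)))
    refl (seq a n) (seq b n) (seq c n) (seq d n) (seq e n) (seq f n))
  (λ n → solveℚ 6 (λ a b c d e f →
      (a :* c :+ :- (b :* d)) :* f :+ (a :* d :+ b :* c) :* e :=
      a :* (c :* f :+ d :* e) :+ b :* (c :* e :+ :- (d :* f)))
    refl (seq a n) (seq b n) (seq c n) (seq d n) (seq e n) (seq f n))

*ᶜ-comm : ∀ x y → x *ᶜ y ≃ y *ᶜ x
*ᶜ-comm (a +i b) (c +i d) = ≗⇒≃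
  (λ n → solveℚ 4 (λ a b c d → a :* c :+ :- (b :* d) := c :* a :+ :- (d :* b))
    refl (seq a n) (seq b n) (seq c n) (seq d n))
  (λ n → solveℚ 4 (λ a b c d → a :* d :+ b :* c := c :* b :+ d :* a)
    refl (seq a n) (seq b n) (seq c n) (seq d n))

*ᶜ-identityˡ : ∀ x → 1ᶜ *ᶜ x ≃ x
*ᶜ-identityˡ (a +i b) = ≗⇒≃
  (λ n → solveℚ 2 (λ a b → con 1ℚ :* a :+ :- (con 0ℚ :* b) := a) refl (seq a n) (seq b n))
  (λ n → solveℚ 2 (λ a b → con 1ℚ :* b :+ con 0ℚ :* a := b) refl (seq a n) (seq b n))

*ᶜ-distribʳ : ∀ x y z → (y +ᶜ z) *ᶜ x ≃ y *ᶜ x +ᶜ z *ᶜ x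
*ᶜ-distribʳ (a +i b) (c +i d) (e +i f) = ≗⇒≃
  (λ n → solveℚ 6 (λ a b c d e f →
      (c :+ e) :* a :+ :- ((d :+ f) :* b) :=
      (c :* a :+ :- (d :* b)) :+ (e :* a :+ :- (f :* b)))
    refl (seq a n) (seq b n) (seq c n) (seq d n) (seq e n) (seq f n))
  (λ n → solveℚ 6 (λ a b c d e f →
      (c :+ e) :* b :+ (d :+ f) :* a := (c :* b :+ d :* a) :+ (e :* b :+ f :* a))
    refl (seq a n) (seq b n) (seq c n) (seq d n) (seq e n) (seq f n))

-- `∑` depends only on addition and zero, so the library's sum lemmas for this ring apply to it
-- although it was defined over `_≈ᶜ_`. The semiring solver handles identities without subtraction;
-- the others are solved on rational components.
ℂ-commutativeRing : CommutativeRing _ _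
ℂ-commutativeRing = record
  { _≈_ = _≃_ ; _+_ = _+ᶜ_ ; _*_ = _*ᶜ_ ; -_ = -ᶜ_ ; 0# = 0ᶜ ; 1# = 1ᶜ
  ; isCommutativeRing = record
    { isRing = record
      { +-isAbelianGroup = record
        { isGroup = record
          { isMonoid = record
            { isSemigroup = record
              { isMagma = record
                { isEquivalence = record { refl = ≃-refl ; sym = ≃-sym ; trans = ≃-trans }
                ; ∙-cong = +ᶜ-cong
                }
              ; assoc = λ x y z → ≗⇒≃
                  (λ n → ℚ.+-assoc (seq (re x) n) (seq (re y) n) (seq (re z) n))
                  (λ n → ℚ.+-assoc (seq (im x) n) (seq (im y) n) (seq (im z) n))
              }
            ; identity =
                (λ x → ≗⇒≃ (λ n → ℚ.+-identityˡ (seq (re x) n)) (λ n → ℚ.+-identityˡ (seq (im x) n))) ,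
                (λ x → ≗⇒≃ (λ n → ℚ.+-identityʳ (seq (re x) n)) (λ n → ℚ.+-identityʳ (seq (im x) n)))
            }
          ; inverse =
              (λ x → ≗⇒≃ (λ n → ℚ.+-inverseˡ (seq (re x) n)) (λ n → ℚ.+-inverseˡ (seq (im x) n))) ,
              (λ x → ≗⇒≃ (λ n → ℚ.+-inverseʳ (seq (re x) n)) (λ n → ℚ.+-inverseʳ (seq (im x) n)))
          ; ⁻¹-cong = -ᶜ-cong
          }
        ; comm = λ x y → ≗⇒≃
            (λ n → ℚ.+-comm (seq (re x) n) (seq (re y) n))
            (λ n → ℚ.+-comm (seq (im x) n) (seq (im y) n))
        }
      ; *-cong = *ᶜ-cong
      ; *-assoc = *ᶜ-assoc
      ; *-identity = *ᶜ-identityˡ , λ x → ≃-trans (*ᶜ-comm x 1ᶜ) (*ᶜ-identityˡ x)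
      ; distrib =
          (λ x y z → ≃-trans (*ᶜ-comm x (y +ᶜ z)) (≃-trans (*ᶜ-distribʳ x y z)
            (+ᶜ-cong (*ᶜ-comm y x) (*ᶜ-comm z x)))) ,
          *ᶜ-distribʳ
      }
    ; *-comm = *ᶜ-comm
    }
  }

module ℂᵣ = CommutativeRing ℂ-commutativeRing
open SemiringSum ℂᵣ.semiring using (sum-cong-≋; *-distribˡ-sum; *-distribʳ-sum; sum-replicate-zero)
open GroupProperties ℂᵣ.+-group using () renaming (x∙y⁻¹≈ε⇒x≈y to x-y≃0⇒x≃y)
open SetoidReasoning ℂᵣ.setoid
open RingProperties ℂᵣ.ring using (-1*x≈-x)
open SemiringSolver ℂᵣ.commutativeSemiring using ()
  renaming (solve to solveℂ; con to κ; _:=_ to _⊜_; _:+_ to _⊕_; _:*_ to _⊗_)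

conj-sub : ∀ z w → conj (z -ᶜ w) ≃ conj z -ᶜ conj w
conj-sub z w = ≗⇒≃ (λ _ → refl)
  (λ n → solveℚ 2 (λ a b → :- (a :+ :- b) := :- a :+ :- (:- b)) refl (seq (im z) n) (seq (im w) n))

fromℚᶜ : ℚ → ℂ
fromℚᶜ p = fromℝ (fromℚ p)

-- Matrix units

[_] : Bool → ℂ
[ b ] = if b then 1ᶜ else 0ᶜ

-- Indicators are real; splitting on `b` turns them into the constants 0 and 1, and each component
-- becomes a rational identity.
conj-scale : ∀ c b → conj (c *ᶜ [ b ]) ≃ conj c *ᶜ [ b ]
conj-scale (x +i y) true = ≗⇒≃
  (λ n → solveℚ 2 (λ a b → a :* con 1ℚ :+ :- (b :* con 0ℚ) := a :* con 1ℚ :+ :- ((:- b) :* con 0ℚ))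
    refl (seq x n) (seq y n))
  (λ n → solveℚ 2 (λ a b → :- (a :* con 0ℚ :+ b :* con 1ℚ) := a :* con 0ℚ :+ (:- b) :* con 1ℚ)
    refl (seq x n) (seq y n))
conj-scale (x +i y) false = ≗⇒≃
  (λ n → solveℚ 2 (λ a b → a :* con 0ℚ :+ :- (b :* con 0ℚ) := a :* con 0ℚ :+ :- ((:- b) :* con 0ℚ))
    refl (seq x n) (seq y n))
  (λ n → solveℚ 2 (λ a b → :- (a :* con 0ℚ :+ b :* con 0ℚ) := a :* con 0ℚ :+ (:- b) :* con 0ℚ)
    refl (seq x n) (seq y n))

[∧] : ∀ a b → [ a ∧ b ] ≃ [ a ] *ᶜ [ b ]
[∧] true  b = ≃-sym (ℂᵣ.*-identityˡ [ b ])
[∧] false b = ≃-sym (ℂᵣ.zeroˡ [ b ])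

∑-indicator : ∀ {n} (i : Fin n) (f : Vector ℂ n) → ∑ (λ k → [ does (i Fin.≟ k) ] *ᶜ f k) ≃ f i
∑-indicator {suc n} zero f = begin
  1ᶜ *ᶜ f zero +ᶜ ∑ (λ k → 0ᶜ *ᶜ f (suc k))
    ≈⟨ ℂᵣ.+-cong (ℂᵣ.*-identityˡ (f zero))
         (ℂᵣ.trans (sum-cong-≋ (λ k → ℂᵣ.zeroˡ (f (suc k)))) (sum-replicate-zero n)) ⟩
  f zero +ᶜ 0ᶜ
    ≈⟨ ℂᵣ.+-identityʳ (f zero) ⟩
  f zero ∎
∑-indicator (suc i) f = begin
  0ᶜ *ᶜ f zero +ᶜ ∑ (λ k → [ does (i Fin.≟ k) ] *ᶜ f (suc k))
    ≈⟨ ℂᵣ.+-cong (ℂᵣ.zeroˡ (f zero)) (∑-indicator i (f ∘ suc)) ⟩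
  0ᶜ +ᶜ f (suc i)
    ≈⟨ ℂᵣ.+-identityˡ (f (suc i)) ⟩
  f (suc i) ∎

-- Left multiplication by E_ab moves row b of X to row a and clears the rest; dually, `*ᵐ-unit`
-- moves column a to column b.
unit-*ᵐ : ∀ {n} c (a b : Fin n) X i j →
  ((c • unit a b) *ᵐ X) i j ≃ c *ᶜ [ does (a Fin.≟ i) ] *ᶜ X b j
unit-*ᵐ c a b X i j = begin
  ∑ (λ k → c *ᶜ [ does (a Fin.≟ i) ∧ does (b Fin.≟ k) ] *ᶜ X k j)
    ≈⟨ sum-cong-≋ (λ k → ℂᵣ.trans
         (ℂᵣ.*-congʳ (ℂᵣ.*-congˡ ([∧] (does (a Fin.≟ i)) (does (b Fin.≟ k)))))
         (solveℂ 4 (λ c p q x → c ⊗ (p ⊗ q) ⊗ x ⊜ q ⊗ (c ⊗ p ⊗ x)) ≃-refl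
           c [ does (a Fin.≟ i) ] [ does (b Fin.≟ k) ] (X k j))) ⟩
  ∑ (λ k → [ does (b Fin.≟ k) ] *ᶜ (c *ᶜ [ does (a Fin.≟ i) ] *ᶜ X k j))
    ≈⟨ ∑-indicator b (λ k → c *ᶜ [ does (a Fin.≟ i) ] *ᶜ X k j) ⟩
  c *ᶜ [ does (a Fin.≟ i) ] *ᶜ X b j ∎

*ᵐ-unit : ∀ {n} c (a b : Fin n) X i j →
  (X *ᵐ (c • unit a b)) i j ≃ X i a *ᶜ (c *ᶜ [ does (b Fin.≟ j) ])
*ᵐ-unit c a b X i j = begin
  ∑ (λ k → X i k *ᶜ (c *ᶜ [ does (a Fin.≟ k) ∧ does (b Fin.≟ j) ]))
    ≈⟨ sum-cong-≋ (λ k → ℂᵣ.trans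
         (ℂᵣ.*-congˡ (ℂᵣ.*-congˡ ([∧] (does (a Fin.≟ k)) (does (b Fin.≟ j)))))
         (solveℂ 4 (λ c p q x → x ⊗ (c ⊗ (p ⊗ q)) ⊜ p ⊗ (x ⊗ (c ⊗ q))) ≃-refl
           c [ does (a Fin.≟ k) ] [ does (b Fin.≟ j) ] (X i k))) ⟩
  ∑ (λ k → [ does (a Fin.≟ k) ] *ᶜ (X i k *ᶜ (c *ᶜ [ does (b Fin.≟ j) ])))
    ≈⟨ ∑-indicator a (λ k → X i k *ᶜ (c *ᶜ [ does (b Fin.≟ j) ])) ⟩
  X i a *ᶜ (c *ᶜ [ does (b Fin.≟ j) ]) ∎

unitᴴ : ∀ {n} c (a b : Fin n) i j → ((c • unit a b) ᴴ) i j ≃ (conj c • unit b a) i j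
unitᴴ c a b i j = ℂᵣ.trans (conj-scale c (does (a Fin.≟ j) ∧ does (b Fin.≟ i)))
  (ℂᵣ.reflexive (cong (λ t → conj c *ᶜ [ t ]) (∧-comm (does (a Fin.≟ j)) (does (b Fin.≟ i)))))

*ᵐ-unitᴴ : ∀ {n} c (a b : Fin n) X i j →
  (X *ᵐ (c • unit a b) ᴴ) i j ≃ X i b *ᶜ (conj c *ᶜ [ does (a Fin.≟ j) ])
*ᵐ-unitᴴ c a b X i j = ℂᵣ.trans
  (sum-cong-≋ (λ k → ℂᵣ.*-congˡ (unitᴴ c a b k j))) (*ᵐ-unit (conj c) b a X i j)

-- E_ab E_ab* = E_aa, with the entries of E_aa kept as products of two indicators.
unit-unitᴴ : ∀ {n} c (a b : Fin n) i j →
  ((c • unit a b) *ᵐ (c • unit a b) ᴴ) i j ≃ c *ᶜ conj c *ᶜ ([ does (a Fin.≟ i) ] *ᶜ [ does (a Fin.≟ j) ])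
unit-unitᴴ c a b i j = begin
  ((c • unit a b) *ᵐ (c • unit a b) ᴴ) i j
    ≈⟨ unit-*ᵐ c a b ((c • unit a b) ᴴ) i j ⟩
  c *ᶜ [ does (a Fin.≟ i) ] *ᶜ conj (c *ᶜ [ does (a Fin.≟ j) ∧ does (b Fin.≟ b) ])
    ≈⟨ ℂᵣ.*-congˡ (conj-scale c (does (a Fin.≟ j) ∧ does (b Fin.≟ b))) ⟩
  c *ᶜ [ does (a Fin.≟ i) ] *ᶜ (conj c *ᶜ [ does (a Fin.≟ j) ∧ does (b Fin.≟ b) ])
    -- The sum has already collapsed to k = b, so the second indicator compares b with itself.
    ≈⟨ ℂᵣ.*-congˡ (ℂᵣ.*-congˡ (ℂᵣ.reflexive (cong [_] (trans
         (cong (does (a Fin.≟ j) ∧_) (dec-true (b Fin.≟ b) refl)) (∧-identityʳ (does (a Fin.≟ j))))))) ⟩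
  c *ᶜ [ does (a Fin.≟ i) ] *ᶜ (conj c *ᶜ [ does (a Fin.≟ j) ])
    ≈⟨ solveℂ 4 (λ c d p q → c ⊗ p ⊗ (d ⊗ q) ⊜ c ⊗ d ⊗ (p ⊗ q)) ≃-refl
         c (conj c) [ does (a Fin.≟ i) ] [ does (a Fin.≟ j) ] ⟩
  c *ᶜ conj c *ᶜ ([ does (a Fin.≟ i) ] *ᶜ [ does (a Fin.≟ j) ]) ∎

unitᴴ-unit : ∀ {n} c (a b : Fin n) i j →
  ((c • unit a b) ᴴ *ᵐ (c • unit a b)) i j ≃ c *ᶜ conj c *ᶜ ([ does (b Fin.≟ i) ] *ᶜ [ does (b Fin.≟ j) ])
unitᴴ-unit c a b i j = begin
  ((c • unit a b) ᴴ *ᵐ (c • unit a b)) i j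
    ≈⟨ *ᵐ-unit c a b ((c • unit a b) ᴴ) i j ⟩
  conj (c *ᶜ [ does (a Fin.≟ a) ∧ does (b Fin.≟ i) ]) *ᶜ (c *ᶜ [ does (b Fin.≟ j) ])
    ≈⟨ ℂᵣ.*-congʳ (conj-scale c (does (a Fin.≟ a) ∧ does (b Fin.≟ i))) ⟩
  conj c *ᶜ [ does (a Fin.≟ a) ∧ does (b Fin.≟ i) ] *ᶜ (c *ᶜ [ does (b Fin.≟ j) ])
    ≈⟨ ℂᵣ.*-congʳ (ℂᵣ.*-congˡ (ℂᵣ.reflexive (cong (λ t → [ t ∧ does (b Fin.≟ i) ])
         (dec-true (a Fin.≟ a) refl)))) ⟩
  conj c *ᶜ [ does (b Fin.≟ i) ] *ᶜ (c *ᶜ [ does (b Fin.≟ j) ])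
    ≈⟨ solveℂ 4 (λ c d p q → d ⊗ p ⊗ (c ⊗ q) ⊜ c ⊗ d ⊗ (p ⊗ q)) ≃-refl
         c (conj c) [ does (b Fin.≟ i) ] [ does (b Fin.≟ j) ] ⟩
  c *ᶜ conj c *ᶜ ([ does (b Fin.≟ i) ] *ᶜ [ does (b Fin.≟ j) ]) ∎

-- E_ab X E_ab* = X_bb E_aa: a graphical tuple sees only the diagonal of X.
unit-conjugation : ∀ {n} c (a b : Fin n) X i j →
  ((c • unit a b) *ᵐ X *ᵐ (c • unit a b) ᴴ) i j ≃
  c *ᶜ conj c *ᶜ ([ does (a Fin.≟ i) ] *ᶜ [ does (a Fin.≟ j) ] *ᶜ X b b)
unit-conjugation c a b X i j = begin
  ((c • unit a b) *ᵐ X *ᵐ (c • unit a b) ᴴ) i j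
    ≈⟨ *ᵐ-unitᴴ c a b ((c • unit a b) *ᵐ X) i j ⟩
  ((c • unit a b) *ᵐ X) i b *ᶜ (conj c *ᶜ [ does (a Fin.≟ j) ])
    ≈⟨ ℂᵣ.*-congʳ (unit-*ᵐ c a b X i b) ⟩
  c *ᶜ [ does (a Fin.≟ i) ] *ᶜ X b b *ᶜ (conj c *ᶜ [ does (a Fin.≟ j) ])
    ≈⟨ solveℂ 5 (λ c d p q x → c ⊗ p ⊗ x ⊗ (d ⊗ q) ⊜ c ⊗ d ⊗ (p ⊗ q ⊗ x)) ≃-refl
         c (conj c) [ does (a Fin.≟ i) ] [ does (a Fin.≟ j) ] (X b b) ⟩
  c *ᶜ conj c *ᶜ ([ does (a Fin.≟ i) ] *ᶜ [ does (a Fin.≟ j) ] *ᶜ X b b) ∎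

-- Sums over the arcs of a graph

-- The sum of E_aa over the arcs (a , b), which is the diagonal matrix of degrees; `head-units` sums
-- E_bb instead.
tail-units : ∀ {n} (G : Graph n) → Matrix n
tail-units G i j = ∑ λ k → let (a , _) = List.lookup (Graph.arcs G) k in
  [ does (a Fin.≟ i) ] *ᶜ [ does (a Fin.≟ j) ]

head-units : ∀ {n} (G : Graph n) → Matrix n
head-units G i j = ∑ λ k → let (_ , b) = List.lookup (Graph.arcs G) k in
  [ does (b Fin.≟ i) ] *ᶜ [ does (b Fin.≟ j) ]

-- A diagonal matrix: its diagonal is the adjacency matrix of G applied to the diagonal of X.
transport : ∀ {n} (G : Graph n) → Matrix n → Matrix n
transport G X i j = ∑ λ k → let (a , b) = List.lookup (Graph.arcs G) k in
  [ does (a Fin.≟ i) ] *ᶜ [ does (a Fin.≟ j) ] *ᶜ X b b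

∑-scaled : ∀ {m} c (u v : Vector ℂ m) → (∀ k → u k ≃ c *ᶜ v k) → ∑ u ≃ c *ᶜ ∑ v
∑-scaled c u v u≃cv = ≃-trans (sum-cong-≋ u≃cv) (≃-sym (*-distribˡ-sum c v))

module _ {n} (G : Graph n) where
  private
    √n : ℂ
    √n = fromℝ (√ᴿ n)

  graphicalTuple-*ᵐᴴ : ∀ i j → ∑ᵐ (λ k → graphicalTuple G k *ᵐ graphicalTuple G k ᴴ) i j ≃
    √n *ᶜ conj √n *ᶜ tail-units G i j
  graphicalTuple-*ᵐᴴ i j = ∑-scaled (√n *ᶜ conj √n)
    (λ k → (graphicalTuple G k *ᵐ graphicalTuple G k ᴴ) i j) _
    (λ k → let (a , b) = List.lookup (Graph.arcs G) k in unit-unitᴴ √n a b i j)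

  graphicalTuple-ᴴ*ᵐ : ∀ i j → ∑ᵐ (λ k → graphicalTuple G k ᴴ *ᵐ graphicalTuple G k) i j ≃
    √n *ᶜ conj √n *ᶜ head-units G i j
  graphicalTuple-ᴴ*ᵐ i j = ∑-scaled (√n *ᶜ conj √n)
    (λ k → (graphicalTuple G k ᴴ *ᵐ graphicalTuple G k) i j) _
    (λ k → let (a , b) = List.lookup (Graph.arcs G) k in unitᴴ-unit √n a b i j)

  -- Every arc carries the same factor √n conj √n, which leaves the sum and is evaluated only for a
  -- concrete graph.
  Φ-graphicalTuple : .{{_ : ℕ.NonZero (List.length (Graph.arcs G))}} → ∀ X i j →
    Φ (graphicalTuple G) X i j ≃
      fromℚᶜ (+ 1 / List.length (Graph.arcs G)) *ᶜ (√n *ᶜ conj √n *ᶜ transport G X i j)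
  Φ-graphicalTuple X i j = *ᶜ-cong ≃-refl
    (∑-scaled (√n *ᶜ conj √n) (λ k → (graphicalTuple G k *ᵐ X *ᵐ graphicalTuple G k ᴴ) i j) _
      (λ k → let (a , b) = List.lookup (Graph.arcs G) k in unit-conjugation √n a b X i j))

-- One-dimensional orthogonal projections

-- The columns of P are multiples of the basis vector β of V, so P = β γᵀ and
-- P P = (Tr P) P; as P fixes β, this gives (Tr P − 1) β = 0.
trace-rank-one : ∀ {n} {V : Subspace n} {P : Matrix n} →
  HasDimension V 1 → IsOrthogonalProjection P V → Tr P ≃ 1ᶜ
trace-rank-one {n} {V} {P} dimV proj =
  -- Linear independence cancels β, in place of division by an entry of β.
  x-y≃0⇒x≃y (Tr P) 1ᶜ (equal (independent (λ _ → Tr P -ᶜ 1ᶜ) (λ i → equality (t-1-kills-β i)) zero))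
  where
  open HasDimension dimV
  open IsOrthogonalProjection proj
  β : Vector ℂ n
  β = basis zero

  column∈V : ∀ j → Subspace._∈V V (λ i → P i j)
  column∈V j = Equivalence.from (range (λ i → P i j))
    -- Column j is P applied to the j-th standard basis vector.
    ((λ k → [ does (j Fin.≟ k) ]) , λ i → equality (begin
      P i j
        ≈⟨ ∑-indicator j (P i) ⟨
      ∑ (λ k → [ does (j Fin.≟ k) ] *ᶜ P i k)
        ≈⟨ sum-cong-≋ (λ k → ℂᵣ.*-comm [ does (j Fin.≟ k) ] (P i k)) ⟩
      ∑ (λ k → P i k *ᶜ [ does (j Fin.≟ k) ]) ∎))

  γ : Vector ℂ n
  γ j = proj₁ (spanning (column∈V j)) zero

  P≃βγ : ∀ i j → P i j ≃ γ j *ᶜ β i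
  P≃βγ i j = ℂᵣ.trans (equal (proj₂ (spanning (column∈V j)) i)) (ℂᵣ.+-identityʳ (γ j *ᶜ β i))

  tP≃P : ∀ i j → Tr P *ᶜ P i j ≃ P i j
  tP≃P i j = begin
    Tr P *ᶜ P i j
      ≈⟨ *-distribʳ-sum (P i j) (λ k → P k k) ⟩
    ∑ (λ k → P k k *ᶜ P i j)
      -- The 2×2 minors of a rank-one matrix vanish: P_kk P_ij = P_ik P_kj.
      ≈⟨ sum-cong-≋ (λ k → begin
           P k k *ᶜ P i j
             ≈⟨ ℂᵣ.*-cong (P≃βγ k k) (P≃βγ i j) ⟩
           γ k *ᶜ β k *ᶜ (γ j *ᶜ β i)
             ≈⟨ solveℂ 4 (λ a b c d → a ⊗ b ⊗ (c ⊗ d) ⊜ a ⊗ d ⊗ (c ⊗ b)) ≃-refl (γ k) (β k) (γ j) (β i) ⟩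
           γ k *ᶜ β i *ᶜ (γ j *ᶜ β k)
             ≈⟨ ℂᵣ.*-cong (P≃βγ i k) (P≃βγ k j) ⟨
           P i k *ᶜ P k j ∎) ⟩
    (P *ᵐ P) i j
      ≈⟨ equal (idempotent i j) ⟩
    P i j ∎

  tβ≃β : ∀ i → Tr P *ᶜ β i ≃ β i
  tβ≃β i = let (y , β≈Py) = Equivalence.to (range β) (basis∈V zero) in begin
    Tr P *ᶜ β i
      ≈⟨ ℂᵣ.*-congˡ (equal (β≈Py i)) ⟩
    Tr P *ᶜ ∑ (λ j → P i j *ᶜ y j)
      ≈⟨ *-distribˡ-sum (Tr P) (λ j → P i j *ᶜ y j) ⟩
    ∑ (λ j → Tr P *ᶜ (P i j *ᶜ y j))
      ≈⟨ sum-cong-≋ (λ j → ℂᵣ.trans (ℂᵣ.sym (ℂᵣ.*-assoc (Tr P) (P i j) (y j))) (ℂᵣ.*-congʳ (tP≃P i j))) ⟩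
    ∑ (λ j → P i j *ᶜ y j)
      ≈⟨ equal (β≈Py i) ⟨
    β i ∎

  t-1-kills-β : ∀ i → linearCombination (λ _ → Tr P -ᶜ 1ᶜ) basis i ≃ 0ᶜ
  t-1-kills-β i = begin
    (Tr P -ᶜ 1ᶜ) *ᶜ β i +ᶜ 0ᶜ
      ≈⟨ ℂᵣ.+-identityʳ _ ⟩
    (Tr P -ᶜ 1ᶜ) *ᶜ β i
      ≈⟨ ℂᵣ.distribʳ (β i) (Tr P) (-ᶜ 1ᶜ) ⟩
    Tr P *ᶜ β i +ᶜ (-ᶜ 1ᶜ) *ᶜ β i
      ≈⟨ ℂᵣ.+-cong (tβ≃β i) (-1*x≈-x (β i)) ⟩
    β i -ᶜ β i
      ≈⟨ ℂᵣ.-‿inverseʳ (β i) ⟩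
    0ᶜ ∎

-- The graph K₂

open RegularGraph using (graph)

edgeExpansion-K₂ : IsEdgeExpansion K₂ 1ℚ
edgeExpansion-K₂ =
  (inside ∷ outside ∷ [] , s≤s z≤n , s≤s (s≤s z≤n) , refl) , lower
  where
  lower : ∀ h → EdgeCutValue K₂ h → 1ℚ ℚ.≤ h
  -- The size bounds leave the two singletons, each cutting the single edge.
  lower h (inside  ∷ inside  ∷ [] , _ , s≤s (s≤s ()) , _)
  lower h (inside  ∷ outside ∷ [] , _ , _ , eq) = ℚ.≤-reflexive (sym eq)
  lower h (outside ∷ inside  ∷ [] , _ , _ , eq) = ℚ.≤-reflexive (sym eq)
  lower h (outside ∷ outside ∷ [] , () , _)

-- Double stochasticity of the tuple of K₂

√2 : ℂ
√2 = fromℝ (√ᴿ 2)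

-- The imaginary part is zero at every index, so the only limit argument is √2 · √2 = 2.
∣√2∣² : √2 *ᶜ conj √2 ≃ fromℚᶜ (+ 2 / 1)
∣√2∣² = ≃-trans
  (≗⇒≃ {w = fromℝ (√ᴿ 2 *ᴿ √ᴿ 2)}
    (λ n → solveℚ 1 (λ a → a :* a :+ :- (con 0ℚ :* (:- con 0ℚ)) := a :* a) refl (√-seq 2 n))
    (λ n → solveℚ 1 (λ a → a :* (:- con 0ℚ) :+ con 0ℚ :* a := con 0ℚ) refl (√-seq 2 n)))
  (equal (√ᴿ-sq 2 , λ ε 0<ε → 0 , λ _ _ → 0<ε))

≃⇒≈ᵐ : ∀ {n} (A C : Matrix n) → (∀ i j → A i j ≃ C i j) → A ≈ᵐ C
≃⇒≈ᵐ A C h i j = equality (h i j)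

-- Both degrees are 1. Every entry is a closed rational expression, so the sequences agree by
-- computation.
tail-units-K₂ : ∀ i j → tail-units (graph K₂) i j ≃ 1ᵐ i j
tail-units-K₂ zero       zero       = ≗⇒≃ (λ _ → refl) (λ _ → refl)
tail-units-K₂ zero       (suc zero) = ≗⇒≃ (λ _ → refl) (λ _ → refl)
tail-units-K₂ (suc zero) zero       = ≗⇒≃ (λ _ → refl) (λ _ → refl)
tail-units-K₂ (suc zero) (suc zero) = ≗⇒≃ (λ _ → refl) (λ _ → refl)

head-units-K₂ : ∀ i j → head-units (graph K₂) i j ≃ 1ᵐ i j
head-units-K₂ zero       zero       = ≗⇒≃ (λ _ → refl) (λ _ → refl)
head-units-K₂ zero       (suc zero) = ≗⇒≃ (λ _ → refl) (λ _ → refl)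
head-units-K₂ (suc zero) zero       = ≗⇒≃ (λ _ → refl) (λ _ → refl)
head-units-K₂ (suc zero) (suc zero) = ≗⇒≃ (λ _ → refl) (λ _ → refl)

-- There are two vertices and two arcs, so the factor √n conj √n already equals m.
doublyStochastic-K₂ : DoublyStochastic (graphicalTuple (graph K₂))
doublyStochastic-K₂ =
  ≃⇒≈ᵐ (∑ᵐ (λ k → graphicalTuple (graph K₂) k *ᵐ graphicalTuple (graph K₂) k ᴴ))
    (fromℚᶜ (+ 2 / 1) • 1ᵐ)
    (λ i j → ≃-trans (graphicalTuple-*ᵐᴴ (graph K₂) i j) (*ᶜ-cong ∣√2∣² (tail-units-K₂ i j))) ,
  ≃⇒≈ᵐ (∑ᵐ (λ k → graphicalTuple (graph K₂) k ᴴ *ᵐ graphicalTuple (graph K₂) k))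
    (fromℚᶜ (+ 2 / 1) • 1ᵐ)
    (λ i j → ≃-trans (graphicalTuple-ᴴ*ᵐ (graph K₂) i j) (*ᶜ-cong ∣√2∣² (head-units-K₂ i j)))

½∣√2∣² : fromℚᶜ ½ *ᶜ (√2 *ᶜ conj √2) ≃ 1ᶜ
½∣√2∣² = ≃-trans (ℂᵣ.*-congˡ {fromℚᶜ ½} ∣√2∣²)
  (≗⇒≃ {fromℚᶜ ½ *ᶜ fromℚᶜ (+ 2 / 1)} {1ᶜ} (λ _ → refl) (λ _ → refl))

-- The map Φ and the cut values for K₂

∑₂ : (f : Vector ℂ 2) → ∑ f ≃ f zero +ᶜ f (suc zero)
∑₂ f = ℂᵣ.+-congˡ (ℂᵣ.+-identityʳ (f (suc zero)))

swapDiagonal : Matrix 2 → Matrix 2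
swapDiagonal X zero       zero       = X (suc zero) (suc zero)
swapDiagonal X zero       (suc zero) = 0ᶜ
swapDiagonal X (suc zero) zero       = 0ᶜ
swapDiagonal X (suc zero) (suc zero) = X zero zero

-- The arcs are listed as (0 , 1), (1 , 0). The `κ` pairs are their tail indicators, and the last
-- `κ 0` is the empty sum.
transport-K₂ : ∀ X i j → transport (graph K₂) X i j ≃ swapDiagonal X i j
transport-K₂ X zero zero =
  solveℂ 2 (λ x y → κ 1 ⊗ κ 1 ⊗ x ⊕ (κ 0 ⊗ κ 0 ⊗ y ⊕ κ 0) ⊜ x) ≃-refl (X (suc zero) (suc zero)) (X zero zero)
transport-K₂ X zero (suc zero) =
  solveℂ 2 (λ x y → κ 1 ⊗ κ 0 ⊗ x ⊕ (κ 0 ⊗ κ 1 ⊗ y ⊕ κ 0) ⊜ κ 0) ≃-refl (X (suc zero) (suc zero)) (X zero zero)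
transport-K₂ X (suc zero) zero =
  solveℂ 2 (λ x y → κ 0 ⊗ κ 1 ⊗ x ⊕ (κ 1 ⊗ κ 0 ⊗ y ⊕ κ 0) ⊜ κ 0) ≃-refl (X (suc zero) (suc zero)) (X zero zero)
transport-K₂ X (suc zero) (suc zero) =
  solveℂ 2 (λ x y → κ 0 ⊗ κ 0 ⊗ x ⊕ (κ 1 ⊗ κ 1 ⊗ y ⊕ κ 0) ⊜ y) ≃-refl (X (suc zero) (suc zero)) (X zero zero)

-- The scalars 1/m and n cancel, leaving `transport` alone: off-diagonal entries are erased and the
-- diagonal ones exchanged.
Φ-K₂ : ∀ X i j → Φ (graphicalTuple (graph K₂)) X i j ≃ swapDiagonal X i j
Φ-K₂ X i j = begin
  Φ (graphicalTuple (graph K₂)) X i j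
    ≈⟨ Φ-graphicalTuple (graph K₂) X i j ⟩
  fromℚᶜ ½ *ᶜ (√2 *ᶜ conj √2 *ᶜ transport (graph K₂) X i j)
    ≈⟨ *ᶜ-assoc (fromℚᶜ ½) (√2 *ᶜ conj √2) (transport (graph K₂) X i j) ⟨
  fromℚᶜ ½ *ᶜ (√2 *ᶜ conj √2) *ᶜ transport (graph K₂) X i j
    ≈⟨ *ᶜ-cong ½∣√2∣² (transport-K₂ X i j) ⟩
  1ᶜ *ᶜ swapDiagonal X i j
    ≈⟨ *ᶜ-identityˡ (swapDiagonal X i j) ⟩
  swapDiagonal X i j ∎

⟨,⟩-cong : ∀ {n} (X X′ Y Y′ : Matrix n) →
  (∀ i j → (X ᴴ) i j ≃ X′ i j) → (∀ i j → Y i j ≃ Y′ i j) → ⟨ X , Y ⟩ ≃ Tr (X′ *ᵐ Y′)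
⟨,⟩-cong X X′ Y Y′ Xᴴ≃ Y≃ = sum-cong-≋ (λ i → sum-cong-≋ (λ k → *ᶜ-cong (Xᴴ≃ i k) (Y≃ k i)))

Tr-*ᵐ-swapDiagonal : ∀ (X Y : Matrix 2) → Tr (X *ᵐ swapDiagonal Y) ≃
  X zero zero *ᶜ Y (suc zero) (suc zero) +ᶜ X (suc zero) (suc zero) *ᶜ Y zero zero
Tr-*ᵐ-swapDiagonal X Y =
  ≃-trans (∑₂ (λ i → ∑ λ k → X i k *ᶜ swapDiagonal Y k i)) (+ᶜ-cong
    (≃-trans (∑₂ (λ k → X zero k *ᶜ swapDiagonal Y k zero))
      (≃-trans (ℂᵣ.+-congˡ (ℂᵣ.zeroʳ (X zero (suc zero)))) (ℂᵣ.+-identityʳ _)))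
    (≃-trans (∑₂ (λ k → X (suc zero) k *ᶜ swapDiagonal Y k (suc zero)))
      (≃-trans (ℂᵣ.+-congʳ (ℂᵣ.zeroʳ (X (suc zero) zero))) (ℂᵣ.+-identityˡ _))))

conj-[] : ∀ b → conj [ b ] ≃ [ b ]
conj-[] true  = ≗⇒≃ (λ _ → refl) (λ _ → refl)
conj-[] false = ≗⇒≃ (λ _ → refl) (λ _ → refl)

conj-1ᵐ : ∀ {n} (i j : Fin n) → conj (1ᵐ j i) ≃ 1ᵐ i j
conj-1ᵐ i j = ≃-trans (conj-[] (does (j Fin.≟ i)))
  (ℂᵣ.reflexive (cong [_] (does-⇔ (mk⇔ sym sym) (j Fin.≟ i) (i Fin.≟ j))))

selfAdjoint-complement : ∀ {n} (P : Matrix n) → P ᴴ ≈ᵐ P → ∀ i j → ((1ᵐ -ᵐ P) ᴴ) i j ≃ (1ᵐ -ᵐ P) i j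
selfAdjoint-complement P Pᴴ≈P i j = ≃-trans (conj-sub (1ᵐ j i) (P j i))
  (ℂᵣ.+-cong (conj-1ᵐ i j) (ℂᵣ.-‿cong (equal (Pᴴ≈P i j))))

-- Self-adjointness removes the adjoint in the inner product; against a diagonal matrix, the trace
-- uses only the diagonal of 1 - P.
cut-K₂ : ∀ P → P ᴴ ≈ᵐ P → ⟨ 1ᵐ -ᵐ P , Φ (graphicalTuple (graph K₂)) P ⟩ ≃
  (1ᶜ -ᶜ P zero zero) *ᶜ P (suc zero) (suc zero) +ᶜ (1ᶜ -ᶜ P (suc zero) (suc zero)) *ᶜ P zero zero
cut-K₂ P Pᴴ≈P = ≃-trans
  (⟨,⟩-cong (1ᵐ -ᵐ P) (1ᵐ -ᵐ P) (Φ (graphicalTuple (graph K₂)) P) (swapDiagonal P)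
    (selfAdjoint-complement P Pᴴ≈P) (Φ-K₂ P))
  (Tr-*ᵐ-swapDiagonal (1ᵐ -ᵐ P) P)

-- As a + b = 1, the left-hand side is b² + a² = ½(a + b)² + ½(a − b)².
trace-one-cut : ∀ a b → conj a ≃ a → conj b ≃ b → a +ᶜ b ≃ 1ᶜ →
  (1ᶜ -ᶜ a) *ᶜ b +ᶜ (1ᶜ -ᶜ b) *ᶜ a ≃ fromℚᶜ ½ +ᶜ fromℚᶜ ½ *ᶜ ((a -ᶜ b) *ᶜ conj (a -ᶜ b))
trace-one-cut a b ā≃a b̄≃b a+b≃1 = begin
  (1ᶜ -ᶜ a) *ᶜ b +ᶜ (1ᶜ -ᶜ b) *ᶜ a
    -- Replacing 1 by a + b makes the expression homogeneous of degree two; what follows is an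
    -- identity in arbitrary a and b.
    ≈⟨ ℂᵣ.+-cong (ℂᵣ.*-congʳ (ℂᵣ.+-congʳ (≃-sym a+b≃1))) (ℂᵣ.*-congʳ (ℂᵣ.+-congʳ (≃-sym a+b≃1))) ⟩
  (a +ᶜ b -ᶜ a) *ᶜ b +ᶜ (a +ᶜ b -ᶜ b) *ᶜ a
    ≈⟨ identity a b ⟩
  fromℚᶜ ½ *ᶜ ((a +ᶜ b) *ᶜ (a +ᶜ b)) +ᶜ fromℚᶜ ½ *ᶜ ((a -ᶜ b) *ᶜ (a -ᶜ b))
    ≈⟨ ℂᵣ.+-cong
         (≃-trans (ℂᵣ.*-congˡ {fromℚᶜ ½} (ℂᵣ.*-cong a+b≃1 a+b≃1)) (≗⇒≃ (λ _ → refl) (λ _ → refl)))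
         -- As a and b are real, one factor may be conjugated. The real part of z conj z is
         -- nonnegative at every index, whereas that of z z need not be: the imaginary
         -- approximations merely tend to 0.
         (ℂᵣ.*-congˡ (ℂᵣ.*-congˡ (≃-sym (≃-trans (conj-sub a b) (ℂᵣ.+-cong ā≃a (ℂᵣ.-‿cong b̄≃b)))))) ⟩
  fromℚᶜ ½ +ᶜ fromℚᶜ ½ *ᶜ ((a -ᶜ b) *ᶜ conj (a -ᶜ b)) ∎
  where
  identity : ∀ a b → (a +ᶜ b -ᶜ a) *ᶜ b +ᶜ (a +ᶜ b -ᶜ b) *ᶜ a ≃
    fromℚᶜ ½ *ᶜ ((a +ᶜ b) *ᶜ (a +ᶜ b)) +ᶜ fromℚᶜ ½ *ᶜ ((a -ᶜ b) *ᶜ (a -ᶜ b))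
  identity (a +i b) (c +i d) = ≗⇒≃
    (λ n → solveℚ 4 (λ a b c d →
        ((a :+ c :+ :- a) :* c :+ :- ((b :+ d :+ :- b) :* d)) :+
        ((a :+ c :+ :- c) :* a :+ :- ((b :+ d :+ :- d) :* b)) :=
        (con ½ :* ((a :+ c) :* (a :+ c) :+ :- ((b :+ d) :* (b :+ d))) :+
          :- (con 0ℚ :* ((a :+ c) :* (b :+ d) :+ (b :+ d) :* (a :+ c)))) :+
        (con ½ :* ((a :+ :- c) :* (a :+ :- c) :+ :- ((b :+ :- d) :* (b :+ :- d))) :+
          :- (con 0ℚ :* ((a :+ :- c) :* (b :+ :- d) :+ (b :+ :- d) :* (a :+ :- c)))))
      refl (seq a n) (seq b n) (seq c n) (seq d n))
    (λ n → solveℚ 4 (λ a b c d →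
        ((a :+ c :+ :- a) :* d :+ (b :+ d :+ :- b) :* c) :+
        ((a :+ c :+ :- c) :* b :+ (b :+ d :+ :- d) :* a) :=
        (con ½ :* ((a :+ c) :* (b :+ d) :+ (b :+ d) :* (a :+ c)) :+
          con 0ℚ :* ((a :+ c) :* (a :+ c) :+ :- ((b :+ d) :* (b :+ d)))) :+
        (con ½ :* ((a :+ :- c) :* (b :+ :- d) :+ (b :+ :- d) :* (a :+ :- c)) :+
          con 0ℚ :* ((a :+ :- c) :* (a :+ :- c) :+ :- ((b :+ :- d) :* (b :+ :- d)))))
      refl (seq a n) (seq b n) (seq c n) (seq d n))

½≤½+½∣e∣² : ∀ e n → ½ ℚ.≤ seq (re (fromℚᶜ ½ +ᶜ fromℚᶜ ½ *ᶜ (e *ᶜ conj e))) n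
½≤½+½∣e∣² (x +i y) n = subst (½ ℚ.≤_)
  -- The terms with `con 0ℚ` come from the imaginary part of the complex number ½.
  (solveℚ 2 (λ x y → con ½ :+ con ½ :* (x :* x :+ y :* y) :=
      con ½ :+ (con ½ :* (x :* x :+ :- (y :* :- y)) :+ :- (con 0ℚ :* (x :* :- y :+ y :* x))))
    refl (seq x n) (seq y n))
  (ℚ.+-monoʳ-≤ ½ {0ℚ} (ℚ.*-monoˡ-≤-nonNeg ½ {0ℚ}
    (ℚ.+-mono-≤ {0ℚ} {seq x n ℚ.* seq x n} {0ℚ} (0≤p² (seq x n)) (0≤p² (seq y n)))))

-- A subspace attaining the minimum

diagonal : Subspace 2
diagonal = record
  -- The span of (1 , 1), given by an equation so that the closure laws are congruences.
  { _∈V      = λ x → x zero ≈ᶜ x (suc zero)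
  ; ∈-resp-≈ = λ {x} {y} x≈y x₀≈x₁ → equality (≃-trans (≃-sym (equal {x zero} {y zero} (x≈y zero)))
      (≃-trans (equal {x zero} {x (suc zero)} x₀≈x₁) (equal {x (suc zero)} {y (suc zero)} (x≈y (suc zero)))))
  ; 0-closed = equality (≃-refl {0ᶜ})
  ; +-closed = λ {x} {y} p q → equality (ℂᵣ.+-cong
      (equal {x zero} {x (suc zero)} p) (equal {y zero} {y (suc zero)} q))
  ; *-closed = λ c {x} p → equality (ℂᵣ.*-congˡ {c} (equal {x zero} {x (suc zero)} p))
  }

dim-diagonal : HasDimension diagonal 1
dim-diagonal = record
  { basis       = λ _ _ → 1ᶜ
  ; basis∈V     = λ _ → equality (≃-refl {1ᶜ})
  ; independent = λ { c h zero → equality (≃-trans (≃-sym (c*1+0 (c zero)))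
      (equal {c zero *ᶜ 1ᶜ +ᶜ 0ᶜ} {0ᶜ} (h zero))) }
  ; spanning    = λ {x} p → (λ _ → x zero) , λ
      { zero       → equality (≃-sym (c*1+0 (x zero)))
      ; (suc zero) → equality (≃-trans (≃-sym (equal {x zero} {x (suc zero)} p)) (≃-sym (c*1+0 (x zero))))
      }
  }
  where
  c*1+0 : ∀ c → c *ᶜ 1ᶜ +ᶜ 0ᶜ ≃ c
  c*1+0 c = ≃-trans (ℂᵣ.+-identityʳ (c *ᶜ 1ᶜ)) (ℂᵣ.*-identityʳ c)

-- This is v vᵀ / 2 for v = (1 , 1), the projection that replaces both coordinates by their average.
diagonal-projection : Matrix 2
diagonal-projection _ _ = fromℚᶜ ½

projection-diagonal : IsOrthogonalProjection diagonal-projection diagonal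
projection-diagonal = record
  { selfAdjoint = λ _ _ → equality (≗⇒≃ {conj (fromℚᶜ ½)} {fromℚᶜ ½} (λ _ → refl) (λ _ → refl))
  ; idempotent  = λ _ _ → equality
      (≗⇒≃ {(diagonal-projection *ᵐ diagonal-projection) zero zero} {fromℚᶜ ½} (λ _ → refl) (λ _ → refl))
  ; range       = λ x → mk⇔
      -- A vector of the subspace is its own preimage, being fixed by averaging.
      (λ x₀≈x₁ → x , λ
        { zero       → equality (average (ℂᵣ.refl {x zero}) (equal {x zero} {x (suc zero)} x₀≈x₁))
        ; (suc zero) → equality (average (≃-sym (equal {x zero} {x (suc zero)} x₀≈x₁)) (ℂᵣ.refl {x (suc zero)}))
        })
      -- The two rows of the projection coincide, so both coordinates of the image are the same
      -- expression.
      (λ (y , x≈Py) → equality (≃-trans (equal {x zero} {(diagonal-projection *ᵐᵛ y) zero} (x≈Py zero))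
        (≃-sym (equal {x (suc zero)} {(diagonal-projection *ᵐᵛ y) zero} (x≈Py (suc zero))))))
  }
  where
  average : ∀ {z x y} → z ≃ x → z ≃ y → z ≃ fromℚᶜ ½ *ᶜ x +ᶜ (fromℚᶜ ½ *ᶜ y +ᶜ 0ᶜ)
  average {z} {x} {y} z≃x z≃y = begin
    z
      ≈⟨ ℂᵣ.*-identityˡ z ⟨
    1ᶜ *ᶜ z
      ≈⟨ ℂᵣ.*-congʳ (≗⇒≃ {1ᶜ} {fromℚᶜ ½ +ᶜ fromℚᶜ ½} (λ _ → refl) (λ _ → refl)) ⟩
    (fromℚᶜ ½ +ᶜ fromℚᶜ ½) *ᶜ z
      ≈⟨ solveℂ 2 (λ h z → (h ⊕ h) ⊗ z ⊜ h ⊗ z ⊕ (h ⊗ z ⊕ κ 0)) ≃-refl (fromℚᶜ ½) z ⟩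
    fromℚᶜ ½ *ᶜ z +ᶜ (fromℚᶜ ½ *ᶜ z +ᶜ 0ᶜ)
      ≈⟨ ℂᵣ.+-cong (ℂᵣ.*-congˡ z≃x) (ℂᵣ.+-congʳ (ℂᵣ.*-congˡ z≃y)) ⟩
    fromℚᶜ ½ *ᶜ x +ᶜ (fromℚᶜ ½ *ᶜ y +ᶜ 0ᶜ) ∎

-- Both diagonal entries are ½, so (a - b)² vanishes and the cut is a closed computation. The scalar
-- 1 is 1 / dim V.
diagonal-cut : fromℚᶜ 1ℚ *ᶜ
  ⟨ 1ᵐ -ᵐ diagonal-projection , Φ (graphicalTuple (graph K₂)) diagonal-projection ⟩ ≃ fromℚᶜ ½
diagonal-cut = begin
  1ᶜ *ᶜ ⟨ 1ᵐ -ᵐ diagonal-projection , Φ (graphicalTuple (graph K₂)) diagonal-projection ⟩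
    ≈⟨ *ᶜ-identityˡ _ ⟩
  ⟨ 1ᵐ -ᵐ diagonal-projection , Φ (graphicalTuple (graph K₂)) diagonal-projection ⟩
    ≈⟨ cut-K₂ diagonal-projection (IsOrthogonalProjection.selfAdjoint projection-diagonal) ⟩
  (1ᶜ -ᶜ fromℚᶜ ½) *ᶜ fromℚᶜ ½ +ᶜ (1ᶜ -ᶜ fromℚᶜ ½) *ᶜ fromℚᶜ ½
    ≈⟨ ≗⇒≃ (λ _ → refl) (λ _ → refl) ⟩
  fromℚᶜ ½ ∎

-- The lower bound on quantum cuts

quantumCut-K₂≥½ : ∀ {V q} P → HasDimension V 1 → IsOrthogonalProjection P V →
  fromℝ q ≃ fromℚᶜ (+ 1 / 1) *ᶜ ⟨ 1ᵐ -ᵐ P , Φ (graphicalTuple (graph K₂)) P ⟩ → fromℚ ½ ≤ᴿ q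
quantumCut-K₂≥½ {V} {q} P dimV proj q≃cut =
  -- The sequence of q itself may dip below ½; the one of `r` does not, and the bound passes along
  -- `q≃r`.
  ≤ᴿ-of-≈-≥ {½} {q} {re r} (proj₁ (equality {fromℝ q} {r} q≃r)) (½≤½+½∣e∣² (a -ᶜ b))
  where
  open IsOrthogonalProjection proj
  a b r : ℂ
  a = P zero zero
  b = P (suc zero) (suc zero)
  r = fromℚᶜ ½ +ᶜ fromℚᶜ ½ *ᶜ ((a -ᶜ b) *ᶜ conj (a -ᶜ b))
  q≃r : fromℝ q ≃ r
  q≃r = begin
    fromℝ q
      ≈⟨ q≃cut ⟩
    fromℚᶜ (+ 1 / 1) *ᶜ ⟨ 1ᵐ -ᵐ P , Φ (graphicalTuple (graph K₂)) P ⟩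
      ≈⟨ *ᶜ-identityˡ _ ⟩
    ⟨ 1ᵐ -ᵐ P , Φ (graphicalTuple (graph K₂)) P ⟩
      ≈⟨ cut-K₂ P selfAdjoint ⟩
    (1ᶜ -ᶜ a) *ᶜ b +ᶜ (1ᶜ -ᶜ b) *ᶜ a
      ≈⟨ trace-one-cut a b
           (equal {conj a} {a} (selfAdjoint zero zero))
           (equal {conj b} {b} (selfAdjoint (suc zero) (suc zero)))
           (≃-trans (≃-sym (∑₂ (λ i → P i i))) (trace-rank-one dimV proj)) ⟩
    r ∎

quantumEdgeExpansion-K₂ : IsQuantumEdgeExpansion (graphicalTuple (graph K₂)) (fromℚ ½)
quantumEdgeExpansion-K₂ = doublyStochastic-K₂ , attained , lower
  where
  attained : QuantumCutValue (graphicalTuple (graph K₂)) (fromℚ ½)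
  attained = diagonal , 1 , diagonal-projection , dim-diagonal , projection-diagonal ,
    s≤s z≤n , s≤s (s≤s z≤n) ,
    equality {fromℚᶜ ½}
      {fromℚᶜ (+ 1 / 1) *ᶜ
        ⟨ 1ᵐ -ᵐ diagonal-projection , Φ (graphicalTuple (graph K₂)) diagonal-projection ⟩}
      (≃-sym diagonal-cut)
  lower : ∀ q → QuantumCutValue (graphicalTuple (graph K₂)) q → fromℚ ½ ≤ᴿ q
  -- 1 ≤ d and 2d ≤ 2 force d = 1.
  lower q (V , 0 , _ , _ , _ , () , _)
  lower q (V , 1 , P , dimV , proj , _ , _ , q≈cut) =
    quantumCut-K₂≥½ {V} {q} P dimV proj
      (equal {fromℝ q} {fromℚᶜ (+ 1 / 1) *ᶜ ⟨ 1ᵐ -ᵐ P , Φ (graphicalTuple (graph K₂)) P ⟩} q≈cut)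
  lower q (V , suc (suc d) , _ , _ , _ , _ , 2d≤2 , _) =
    contradiction (ℕ.*-cancelˡ-≤ {suc (suc d)} {1} 2 2d≤2) λ { (s≤s ()) }

proposition1p14 : IsEdgeExpansion K₂ 1ℚ ×
    (∃ λ q → IsQuantumEdgeExpansion (graphicalTuple (RegularGraph.graph K₂)) q × q ≤ᴿ fromℚ ½)
-- The witness is the exact value ½, so the final inequality is reflexivity.
proposition1p14 = edgeExpansion-K₂ , fromℚ ½ , quantumEdgeExpansion-K₂ ,
  ≤ᴿ-of-≈-≥ {½} {fromℚ ½} {fromℚ ½} (≗⇒≈ᴿ {fromℚ ½} {fromℚ ½} (λ _ → refl)) (λ _ → ℚ.≤-refl)
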